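{- $f(4) \leq 21$. That is, every $2$-edge connected graph of diameter $4$ has a strong orientation of diameter at most $21$.
   Context: An orientation of an undirected graph $G$ assigns exactly one direction to each edge. The diameter of a directed graph is the maximum, over ordered pairs of vertices $(u,v)$, of the length of a shortest directed path from $u$ to $v$. The oriented diameter of $G$ is the minimum diameter over all orientations of $G$. $f(d)$ denotes the maximum oriented diameter over all $2$-edge connected (connected and bridgeless) graphs of diameter $d$. -}

module Defs where

open import Data.Nat using (ℕ; zero; suc; _≤_)
open import Data.Fin using (Fin)
open import Data.Product using (Σ; ∃; ∃-syntax; _×_; _,_)
open import Data.Sum using (_⊎_)
open import Relation.Nullary using (¬_)
open import Relation.Binary.PropositionalEquality using (_≡_)

record Graph : Set₁ where
  field
    n      : ℕ
    Adj    : Fin n → Fin n → Set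
    sym    : ∀ {u v} → Adj u v → Adj v u
    irrefl : ∀ {u} → ¬ Adj u u
open Graph public

data Walk {n : ℕ} (R : Fin n → Fin n → Set) : Fin n → Fin n → ℕ → Set where
  here : ∀ {u} → Walk R u u 0
  step : ∀ {u w v k} → R u w → Walk R w v k → Walk R u v (suc k)

DistLe : {n : ℕ} → (Fin n → Fin n → Set) → Fin n → Fin n → ℕ → Set
DistLe R u v k = ∃[ m ] (m ≤ k × Walk R u v m)

Connected : {n : ℕ} → (Fin n → Fin n → Set) → Set
Connected {n} R = ∀ (u v : Fin n) → ∃[ k ] Walk R u v k

DiamLe : {n : ℕ} → (Fin n → Fin n → Set) → ℕ → Set
DiamLe {n} R d = ∀ (u v : Fin n) → DistLe R u v d

HasDiameter : Graph → ℕ → Set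
HasDiameter G zero    = DiamLe (Adj G) zero
HasDiameter G (suc d) =
  DiamLe (Adj G) (suc d) × ∃[ u ] ∃[ v ] ¬ DistLe (Adj G) u v d

DeleteEdge : (G : Graph) → Fin (n G) → Fin (n G) → Fin (n G) → Fin (n G) → Set
DeleteEdge G a b x y = Adj G x y × ¬ (x ≡ a × y ≡ b) × ¬ (x ≡ b × y ≡ a)

TwoEdgeConnected : Graph → Set
TwoEdgeConnected G =
  Connected (Adj G) ×
  (∀ a b → Adj G a b → Connected (DeleteEdge G a b))

IsOrientation : (G : Graph) → (Fin (n G) → Fin (n G) → Set) → Set
IsOrientation G D =
  (∀ u v → D u v → Adj G u v) ×
  (∀ u v → Adj G u v → (D u v × ¬ D v u) ⊎ (D v u × ¬ D u v))

{-# OPTIONS --safe #-}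
module Submission where

-- Orient a subgraph containing a root arc p → q so that every vertex reaches p, and is reached from q,
-- within 10 steps; then all distances are at most 10 + 1 + 10. A core in which these distances are at
-- most 8 is enlarged by ears, closing cycles of length at most 5 in the contraction of the core, until
-- it dominates the graph; a vertex adjacent to the core then costs two more steps either way.
-- The core depends on the largest k such that some edge pq lies on no cycle shorter than k:
--   k = 3: a single vertex, enlarged four times by its neighbours at a cost of two each;
--   k = 4: a 4-cycle, then the neighbours of p and q, then ears across the graph;
--   k ≥ 5: ears from q through the vertices nearer to q, crossing to those nearer to p, and on to p.
-- When k ≥ 5, vertices equidistant from p and q count as nearer to q. This fails only if some vertex is
-- at distance at least 4 from the p-side; if it fails for both (p , q) and (q , p), extra ears help.

open import Defs hiding (n; sym; irrefl)
open import Data.Bool using (if_then_else_)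
open import Data.Empty using (⊥; ⊥-elim)
open import Data.Fin using (Fin; toℕ)
open import Data.Fin.Properties using (any?; toℕ-injective) renaming (_≟_ to _≟ᶠ_)
open import Data.List using (List; []; _∷_; _++_; allFin; concatMap)
open import Data.List.Membership.Propositional using (_∈_; _∉_; find; lose)
open import Data.List.Membership.Propositional.Properties
  using (∈-allFin; ∈-++⁺ˡ; ∈-++⁺ʳ; ∈-++⁻; ∈-concatMap⁺; ∈-concatMap⁻)
open import Data.List.Relation.Binary.Subset.Propositional using (_⊆_)
open import Data.List.Relation.Unary.All as All using (All; []; _∷_)
open import Data.List.Relation.Unary.AllPairs using ([]; _∷_)
open import Data.List.Relation.Unary.Any using (here; there)
open import Data.List.Relation.Unary.Unique.Propositional using (Unique)
open import Data.Nat using (ℕ; zero; suc; _+_; _∸_; _*_; _≤_; _<_; z≤n; s≤s; s≤s⁻¹; _≤?_; _<?_)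
open import Data.Nat.Properties
open import Data.Nat.Solver using (module +-*-Solver)
open import Data.Product using (Σ; ∃; ∃-syntax; _×_; _,_; proj₁; proj₂)
open import Data.Product.Properties using (≡-dec)
open import Data.Sum using (_⊎_; inj₁; inj₂; [_,_]′)
open import Function using (_∘_; id)
open import Relation.Binary using (tri<; tri≈; tri>)
open import Relation.Binary.PropositionalEquality using (_≡_; _≢_; refl; sym; trans; cong; subst)
open import Relation.Nullary using (¬_; Dec; yes; no; contradiction)
open import Relation.Nullary.Decidable
  using (_×-dec_; _⊎-dec_; ¬?; decidable-stable; does; dec-true; dec-false)
import Data.List.Membership.DecPropositional as DecMembership
open +-*-Solver using (solve; _:+_; _:=_; con)

-- The 10 splits as 8 + 2, the 2 being the price of the last layer. An ear with m inner vertices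
-- that joins a hub to a vertex with bound b on one side has distances at most m + b on that side
-- and 4 + m on the other. So b may be 6, 5, 4 for m = 2, 3, 4, and these are the constants of
-- `Tame`, `Near` and `Hub`. The difficulty is then less to find a core with distances at most 8
-- than one from which no vertex is remote: each must lie in the core, next to a core vertex with
-- bound 5 on one side, or two steps from a hub. The extra care in the cases k = 4 and k ≥ 5 serves
-- this requirement.

private
  variable
    n : ℕ
    V : Set

_∈?_ : (v : Fin n) (vs : List (Fin n)) → Dec (v ∈ vs)
_∈?_ = DecMembership._∈?_ _≟ᶠ_

_∈ᵃ?_ : (a : Fin n × Fin n) (as : List (Fin n × Fin n)) → Dec (a ∈ as)
_∈ᵃ?_ = DecMembership._∈?_ (≡-dec _≟ᶠ_ _≟ᶠ_)

-- Partial orientations and ears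

data Link (R : V → V → Set) : V → List V → V → Set where
  end : ∀ {u v} → R u v → Link R u [] v
  _◂_ : ∀ {u w v l} → R u w → Link R w l v → Link R u (w ∷ l) v

infixr 5 _◂_

Link-map : ∀ {R Q : V → V → Set} → (∀ {u v} → R u v → Q u v) → ∀ {u l v} → Link R u l v → Link Q u l v
Link-map f (end r)  = end (f r)
Link-map f (r ◂ rs) = f r ◂ Link-map f rs

-- In and out distances are measured to and from a root arc p → q; the distance between q and p
-- against this arc is booked as δ on either side, so that both roots look close in both directions.
data To (as : List (Fin n × Fin n)) (p q : Fin n) (δ : ℕ) : Fin n → ℕ → Set where
  at-p : ∀ {k} → To as p q δ p k
  at-q : ∀ {k} → δ ≤ k → To as p q δ q k
  step : ∀ {u v k} → (u , v) ∈ as → To as p q δ v k → To as p q δ u (suc k)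

data From (as : List (Fin n × Fin n)) (p q : Fin n) (δ : ℕ) : Fin n → ℕ → Set where
  at-q : ∀ {k} → From as p q δ q k
  at-p : ∀ {k} → δ ≤ k → From as p q δ p k
  step : ∀ {u v k} → (u , v) ∈ as → From as p q δ u k → From as p q δ v (suc k)

To-≤ : ∀ {as : List (Fin n × Fin n)} {p q δ v k l} → k ≤ l → To as p q δ v k → To as p q δ v l
To-≤ k≤l at-p            = at-p
To-≤ k≤l (at-q δ≤k)      = at-q (≤-trans δ≤k k≤l)
To-≤ (s≤s k≤l) (step a t) = step a (To-≤ k≤l t)

From-≤ : ∀ {as : List (Fin n × Fin n)} {p q δ v k l} → k ≤ l → From as p q δ v k → From as p q δ v l
From-≤ k≤l at-q            = at-q
From-≤ k≤l (at-p δ≤k)      = at-p (≤-trans δ≤k k≤l)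
From-≤ (s≤s k≤l) (step a t) = step a (From-≤ k≤l t)

To-⊆ : ∀ {as bs : List (Fin n × Fin n)} {p q δ ε v k} → as ⊆ bs → ε ≤ δ → To as p q δ v k → To bs p q ε v k
To-⊆ s e at-p       = at-p
To-⊆ s e (at-q δ≤k) = at-q (≤-trans e δ≤k)
To-⊆ s e (step a t) = step (s a) (To-⊆ s e t)

From-⊆ : ∀ {as bs : List (Fin n × Fin n)} {p q δ ε v k} → as ⊆ bs → ε ≤ δ → From as p q δ v k → From bs p q ε v k
From-⊆ s e at-q       = at-q
From-⊆ s e (at-p δ≤k) = at-p (≤-trans e δ≤k)
From-⊆ s e (step a t) = step (s a) (From-⊆ s e t)

record Partial (X : Fin n → Fin n → Set) : Set where
  constructor partial
  field
    verts   : List (Fin n)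
    arcs    : List (Fin n × Fin n)
    allowed : ∀ {u v} → (u , v) ∈ arcs → X u v
    anti    : ∀ {u v} → (u , v) ∈ arcs → (v , u) ∉ arcs
    tail∈   : ∀ {u v} → (u , v) ∈ arcs → u ∈ verts
    head∈   : ∀ {u v} → (u , v) ∈ arcs → v ∈ verts
open Partial

Arc : {X : Fin n → Fin n → Set} → Partial X → Fin n → Fin n → Set
Arc s u v = (u , v) ∈ arcs s

record _⊑_ {X Y : Fin n → Fin n → Set} (s : Partial X) (t : Partial Y) : Set where
  constructor extends
  field
    verts⊆ : verts s ⊆ verts t
    arcs⊆  : arcs s ⊆ arcs t
open _⊑_

⊑-refl : {X : Fin n → Fin n → Set} {s : Partial X} → s ⊑ s
⊑-refl = extends id id

⊑-trans : {X Y Z : Fin n → Fin n → Set} {s : Partial X} {t : Partial Y} {u : Partial Z} → s ⊑ t → t ⊑ u → s ⊑ u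
⊑-trans (extends a b) (extends c d) = extends (c ∘ a) (d ∘ b)

-- Vertices are treated one at a time; monotonicity keeps the earlier ones done while the later ones
-- enlarge the orientation.
coverAll : {X : Fin n → Fin n → Set} (Good : Partial X → Set) (Done : Partial X → Fin n → Set) →
  (∀ {s t v} → s ⊑ t → Done s v → Done t v) →
  (∀ s → Good s → ∀ v → ∃[ t ] (s ⊑ t × Good t × Done t v)) →
  ∀ s → Good s → ∃[ t ] (s ⊑ t × Good t × (∀ v → Done t v))
coverAll {n = n} Good Done mono next s good =
  let t , s⊑t , g , d = go (allFin n) in t , s⊑t , g , λ v → All.lookup d (∈-allFin v)
  where
  go : ∀ vs → ∃[ t ] (s ⊑ t × Good t × All (Done t) vs)
  go []       = s , ⊑-refl , good , []
  go (v ∷ vs) with go vs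
  ... | t , s⊑t , g , ds with next t g v
  ... | t′ , t⊑t′ , g′ , d = t′ , ⊑-trans s⊑t t⊑t′ , g′ , d ∷ All.map (mono t⊑t′) ds

module _ {X : Fin n → Fin n → Set} where

  insertArc : (s : Partial X) {u v : Fin n} → X u v → u ≢ v → (v , u) ∉ arcs s → u ∈ verts s → v ∈ verts s →
    ∃[ t ] (s ⊑ t × Arc t u v × verts t ≡ verts s × arcs t ≡ (u , v) ∷ arcs s)
  insertArc (partial vs as al an ta he) {u} {v} x u≢v vu∉ u∈ v∈ =
    partial vs ((u , v) ∷ as)
      (λ { (here refl) → x ; (there a) → al a })
      (λ { (here refl) (here refl) → u≢v refl
         ; (here refl) (there b) → vu∉ b
         ; (there a) (here refl) → vu∉ a
         ; (there a) (there b) → an a b })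
      (λ { (here refl) → u∈ ; (there a) → ta a })
      (λ { (here refl) → v∈ ; (there a) → he a })
    , extends id there , here refl , refl , refl

  insertVertex : Fin n → Partial X → Partial X
  insertVertex d (partial vs as al an ta he) = partial (d ∷ vs) as al an (there ∘ ta) (there ∘ he)

  -- The chain is built from its far end g, so d enters last and its out-arcs lead into the chain,
  -- or to g when l is empty. The last component records this for `insertEar`, where the arc from y
  -- to d must not reverse an existing arc.
  insertTail : (s : Partial X) {d : Fin n} {l : List (Fin n)} {g : Fin n} → Link X d l g → g ∈ verts s →
    All (_∉ verts s) (d ∷ l) → Unique (d ∷ l) →
    ∃[ t ] (s ⊑ t × Link (Arc t) d l g × verts t ≡ d ∷ l ++ verts s ×
            (∀ {w} → Arc t d w → (l ≡ [] × w ≡ g) ⊎ w ∈ l))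
  insertTail s {d} {.[]} {g} (end x) g∈ (d∉ ∷ []) _
    with insertArc (insertVertex d s) {d} {g} x (λ { refl → d∉ g∈ }) (λ a → d∉ (head∈ s a)) (here refl) (there g∈)
  ... | t , e , a , vs≡ , as≡ =
    t , ⊑-trans (extends there id) e , end a , vs≡ , λ {w} b → out (subst ((d , w) ∈_) as≡ b)
    where
    out : ∀ {w} → (d , w) ∈ (d , g) ∷ arcs s → ([] ≡ [] × w ≡ g) ⊎ w ∈ []
    out (here refl) = inj₁ (refl , refl)
    out (there b)   = contradiction (tail∈ s b) d∉
  insertTail s {d} {e ∷ l} {g} (x ◂ xs) g∈ (d∉ ∷ l∉) (d# ∷ l#) with insertTail s xs g∈ l∉ l#
  ... | t₁ , s⊑t₁ , lk , vs₁≡ , _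
    with insertArc (insertVertex d t₁) {d} {e} x (All.head d#) (λ a → d∉t₁ (head∈ t₁ a)) (here refl)
           (there (subst (e ∈_) (sym vs₁≡) (here refl)))
    where
    d∉t₁ : d ∉ verts t₁
    d∉t₁ d∈ with ∈-++⁻ (e ∷ l) (subst (d ∈_) vs₁≡ d∈)
    ... | inj₁ d∈l = All.lookup d# d∈l refl
    ... | inj₂ d∈s = d∉ d∈s
  ... | t , ext , a , vs≡ , as≡ =
    t , ⊑-trans s⊑t₁ (⊑-trans (extends there id) ext) , a ◂ Link-map (arcs⊆ ext) lk
      , trans vs≡ (cong (d ∷_) vs₁≡) , λ {w} b → out (subst ((d , w) ∈_) as≡ b)
    where
    out : ∀ {w} → (d , w) ∈ (d , e) ∷ arcs t₁ → (e ∷ l ≡ [] × w ≡ g) ⊎ w ∈ e ∷ l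
    out (here refl) = inj₂ (here refl)
    out (there b) with ∈-++⁻ (e ∷ l) (subst (d ∈_) vs₁≡ (tail∈ t₁ b))
    ... | inj₁ d∈l = contradiction refl (All.lookup d# d∈l)
    ... | inj₂ d∈s = contradiction d∈s d∉

  -- The last hypothesis excludes an ear with one inner vertex that returns to its start, which
  -- would use a single edge in both directions.
  insertEar : (s : Partial X) {y g d : Fin n} {l : List (Fin n)} → Link X y (d ∷ l) g → y ∈ verts s → g ∈ verts s →
    All (_∉ verts s) (d ∷ l) → Unique (d ∷ l) → y ≢ g ⊎ l ≢ [] →
    ∃[ t ] (s ⊑ t × Link (Arc t) y (d ∷ l) g × verts t ≡ d ∷ l ++ verts s)
  insertEar s {y} {g} {d} {l} (x ◂ xs) y∈ g∈ new uniq cond with insertTail s xs g∈ new uniq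
  ... | t₁ , s⊑t₁ , lk , vs₁≡ , out
    with insertArc t₁ {y} {d} x (λ { refl → All.head new y∈ }) dy∉ (verts⊆ s⊑t₁ y∈) (subst (d ∈_) (sym vs₁≡) (here refl))
    where
    dy∉ : (d , y) ∉ arcs t₁
    dy∉ a with out a
    ... | inj₁ (l≡[] , refl) = [ (λ y≢g → y≢g refl) , (λ l≢ → l≢ l≡[]) ]′ cond
    ... | inj₂ y∈l = All.lookup (All.tail new) y∈l y∈
  ... | t , ext , a , vs≡ , _ = t , ⊑-trans s⊑t₁ ext , a ◂ Link-map (arcs⊆ ext) lk , trans vs≡ vs₁≡

  ear : (P : Partial X → Fin n → Set) → (∀ {s t v} → s ⊑ t → P s v → P t v) →
    (s : Partial X) → (∀ {v} → v ∈ verts s → P s v) →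
    {y g d : Fin n} {l : List (Fin n)} → Link X y (d ∷ l) g → y ∈ verts s → g ∈ verts s →
    All (_∉ verts s) (d ∷ l) → Unique (d ∷ l) → y ≢ g ⊎ l ≢ [] →
    (∀ t → s ⊑ t → Link (Arc t) y (d ∷ l) g → All (P t) (d ∷ l)) →
    ∃[ t ] (s ⊑ t × (∀ {v} → v ∈ verts t → P t v) × All (_∈ verts t) (d ∷ l))
  ear P mono s inv {l = l} lk y∈ g∈ new uniq cond new-inv with insertEar s lk y∈ g∈ new uniq cond
  ... | t , s⊑t , lk′ , vs≡ = t , s⊑t , inv′ , All.tabulate (λ v∈ → subst (_ ∈_) (sym vs≡) (∈-++⁺ˡ v∈))
    where
    inv′ : ∀ {v} → v ∈ verts t → P t v
    inv′ v∈ with ∈-++⁻ (_ ∷ l) (subst (_ ∈_) vs≡ v∈)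
    ... | inj₁ v∈l = All.lookup (new-inv t s⊑t lk′) v∈l
    ... | inj₂ v∈s = mono s⊑t (inv v∈s)

In Out : {X : Fin n → Fin n → Set} → Fin n → Fin n → ℕ → Partial X → Fin n → ℕ → Set
In  p q δ s = To (arcs s) p q δ
Out p q δ s = From (arcs s) p q δ

Avoiding : (Fin n → Fin n → Set) → Fin n → Fin n → Fin n → Fin n → Set
Avoiding E a b x y = E x y × ¬ (x ≡ a × y ≡ b) × ¬ (x ≡ b × y ≡ a)

-- Covering a graph from a core

module Extension {n : ℕ} (E : Fin n → Fin n → Set) (E-sym : ∀ {u v} → E u v → E v u)
                 (E-irrefl : ∀ {u} → ¬ E u u) where

  E⇒≢ : ∀ {u v} → E u v → u ≢ v
  E⇒≢ e refl = E-irrefl e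

  orientEdge : (s : Partial E) {u v : Fin n} → E u v → u ∈ verts s → v ∈ verts s →
    ∃[ t ] (s ⊑ t × verts t ≡ verts s × (Arc t u v ⊎ Arc t v u))
  orientEdge s {u} {v} e u∈ v∈ with (v , u) ∈ᵃ? arcs s
  ... | yes a = s , ⊑-refl , refl , inj₂ a
  ... | no  a∉ with insertArc s e (E⇒≢ e) a∉ u∈ v∈
  ... | t , s⊑t , a , vs≡ , _ = t , s⊑t , vs≡ , inj₁ a

  module Rooted (p q : Fin n) (δ : ℕ) where

    I O : Partial E → Fin n → ℕ → Set
    I = In p q δ
    O = Out p q δ

    I-⊑ : ∀ {s t v k} → s ⊑ t → I s v k → I t v k
    I-⊑ s⊑t = To-⊆ (arcs⊆ s⊑t) ≤-refl

    O-⊑ : ∀ {s t v k} → s ⊑ t → O s v k → O t v k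
    O-⊑ s⊑t = From-⊆ (arcs⊆ s⊑t) ≤-refl

    -- An ear with at most four inner vertices from a hub to a hub keeps all distances at most
    -- 4 + 4 = 8; the last layer then brings them to at most 10.
    Hub : Partial E → Fin n → Set
    Hub s v = v ∈ verts s × I s v 4 × O s v 4

    Hub-⊑ : ∀ {s t v} → s ⊑ t → Hub s v → Hub t v
    Hub-⊑ s⊑t (v∈ , i , o) = verts⊆ s⊑t v∈ , I-⊑ s⊑t i , O-⊑ s⊑t o

    -- The one-sided 6 reproduces itself: each inner vertex of a new ear is, in one direction,
    -- within two steps of a hub or one step from an end with bound 5.
    Tame : Partial E → Fin n → Set
    Tame s v = I s v 8 × O s v 8 × (I s v 6 ⊎ O s v 6)

    Tame-⊑ : ∀ {s t v} → s ⊑ t → Tame s v → Tame t v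
    Tame-⊑ s⊑t (i , o , inj₁ i′) = I-⊑ s⊑t i , O-⊑ s⊑t o , inj₁ (I-⊑ s⊑t i′)
    Tame-⊑ s⊑t (i , o , inj₂ o′) = I-⊑ s⊑t i , O-⊑ s⊑t o , inj₂ (O-⊑ s⊑t o′)

    Near : Partial E → Fin n → Set
    Near s w = ∃[ y ] (E w y × y ∈ verts s × (I s y 5 ⊎ O s y 5))

    Near-⊑ : ∀ {s t v} → s ⊑ t → Near s v → Near t v
    Near-⊑ s⊑t (y , e , y∈ , inj₁ i) = y , e , verts⊆ s⊑t y∈ , inj₁ (I-⊑ s⊑t i)
    Near-⊑ s⊑t (y , e , y∈ , inj₂ o) = y , e , verts⊆ s⊑t y∈ , inj₂ (O-⊑ s⊑t o)

    Reachable : Partial E → Fin n → Set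
    Reachable s w = w ∈ verts s ⊎ Near s w ⊎ ∃[ d ] ∃[ y ] (E w d × E d y × Hub s y)

    Reachable-⊑ : ∀ {s t v} → s ⊑ t → Reachable s v → Reachable t v
    Reachable-⊑ s⊑t (inj₁ v∈)                          = inj₁ (verts⊆ s⊑t v∈)
    Reachable-⊑ s⊑t (inj₂ (inj₁ nr))                   = inj₂ (inj₁ (Near-⊑ s⊑t nr))
    Reachable-⊑ s⊑t (inj₂ (inj₂ (d , y , e , e′ , h))) = inj₂ (inj₂ (d , y , e , e′ , Hub-⊑ s⊑t h))

    AllTame : Partial E → Set
    AllTame s = ∀ {v} → v ∈ verts s → Tame s v

    Covered : Partial E → Fin n → Set
    Covered s d = ∃[ t ] (s ⊑ t × AllTame t × d ∈ verts t)

    pick : ∀ {P : Partial E → Fin n → Set} {s : Partial E} {d ds} → d ∈ ds →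
      ∃[ t ] (s ⊑ t × (∀ {v} → v ∈ verts t → P t v) × All (_∈ verts t) ds) →
      ∃[ t ] (s ⊑ t × (∀ {v} → v ∈ verts t → P t v) × d ∈ verts t)
    pick d∈ (t , s⊑t , inv , ds) = t , s⊑t , inv , All.lookup ds d∈

    -- Ears with one to four inner vertices and an end at a hub

    module _ (s : Partial E) (tame : AllTame s) {d y : Fin n} (d∉ : d ∉ verts s) (e-dy : E d y) (hub : Hub s y) where

      private
        y∈ : y ∈ verts s
        y∈ = proj₁ hub

      -- Whichever one-sided bound u has decides the direction: the ear runs into u if the
      -- in-distance is small and out of u otherwise. The hub can serve as either end. The same
      -- holds for `ear₂` and `ear₃`.
      ear₁ : ∀ {u} → E d u → u ∈ verts s → u ≢ y → Covered s d
      ear₁ {u} e-du u∈ u≢y with proj₂ (proj₂ (tame u∈))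
      ... | inj₁ i =
        pick (here refl) (ear Tame Tame-⊑ s tame (E-sym e-dy ◂ end e-du) y∈ u∈ (d∉ ∷ []) ([] ∷ []) (inj₁ (u≢y ∘ sym))
               (λ { t e (a ◂ end b) →
                 (To-≤ (m≤m+n 7 1) (step b (I-⊑ e i)) , From-≤ (m≤m+n 5 3) (step a (O-⊑ e (proj₂ (proj₂ hub))))
                 , inj₂ (From-≤ (m≤m+n 5 1) (step a (O-⊑ e (proj₂ (proj₂ hub)))))) ∷ [] }))
      ear₁ {u} e-du u∈ u≢y | inj₂ o =
        pick (here refl) (ear Tame Tame-⊑ s tame (E-sym e-du ◂ end e-dy) u∈ y∈ (d∉ ∷ []) ([] ∷ []) (inj₁ u≢y)
               (λ { t e (a ◂ end b) →
                 (To-≤ (m≤m+n 5 3) (step b (I-⊑ e (proj₁ (proj₂ hub)))) , From-≤ (m≤m+n 7 1) (step a (O-⊑ e o))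
                 , inj₁ (To-≤ (m≤m+n 5 1) (step b (I-⊑ e (proj₁ (proj₂ hub)))))) ∷ [] }))

      ear₂ : ∀ {x u} → E d x → x ∉ verts s → E x u → u ∈ verts s → Covered s d
      ear₂ {x} {u} e-dx x∉ e-xu u∈ with proj₂ (proj₂ (tame u∈))
      ... | inj₁ i =
        pick (here refl) (ear Tame Tame-⊑ s tame (E-sym e-dy ◂ e-dx ◂ end e-xu) y∈ u∈ (d∉ ∷ x∉ ∷ [])
               ((E⇒≢ e-dx ∷ []) ∷ [] ∷ []) (inj₂ λ ())
               (λ { t e (a ◂ b ◂ end c) →
                 let i-x = step c (I-⊑ e i)
                     i-d = step b i-x
                     o-d = step a (O-⊑ e (proj₂ (proj₂ hub)))
                     o-x = step b o-d
                 in (i-d , From-≤ (m≤m+n 5 3) o-d , inj₂ (From-≤ (m≤m+n 5 1) o-d))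
                  ∷ (To-≤ (m≤m+n 7 1) i-x , From-≤ (m≤m+n 6 2) o-x , inj₂ o-x) ∷ [] }))
      ear₂ {x} {u} e-dx x∉ e-xu u∈ | inj₂ o =
        pick (there (here refl)) (ear Tame Tame-⊑ s tame (E-sym e-xu ◂ E-sym e-dx ◂ end e-dy) u∈ y∈ (x∉ ∷ d∉ ∷ [])
               ((E⇒≢ (E-sym e-dx) ∷ []) ∷ [] ∷ []) (inj₂ λ ())
               (λ { t e (a ◂ b ◂ end c) →
                 let o-x = step a (O-⊑ e o)
                     o-d = step b o-x
                     i-d = step c (I-⊑ e (proj₁ (proj₂ hub)))
                     i-x = step b i-d
                 in (To-≤ (m≤m+n 6 2) i-x , From-≤ (m≤m+n 7 1) o-x , inj₁ i-x)
                  ∷ (To-≤ (m≤m+n 5 3) i-d , o-d , inj₁ (To-≤ (m≤m+n 5 1) i-d)) ∷ [] }))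

      ear₃ : ∀ {x z u} → E d x → x ∉ verts s → E x z → z ∉ verts s → d ≢ z → E z u → u ∈ verts s →
             I s u 5 ⊎ O s u 5 → Covered s d
      ear₃ {x} {z} {u} e-dx x∉ e-xz z∉ d≢z e-zu u∈ (inj₁ i) =
        pick (here refl) (ear Tame Tame-⊑ s tame (E-sym e-dy ◂ e-dx ◂ e-xz ◂ end e-zu) y∈ u∈ (d∉ ∷ x∉ ∷ z∉ ∷ [])
               ((E⇒≢ e-dx ∷ d≢z ∷ []) ∷ (E⇒≢ e-xz ∷ []) ∷ [] ∷ []) (inj₂ λ ())
               (λ { t e (a ◂ b ◂ c ◂ end f) →
                 let i-z = step f (I-⊑ e i)
                     i-x = step c i-z
                     i-d = step b i-x
                     o-d = step a (O-⊑ e (proj₂ (proj₂ hub)))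
                     o-x = step b o-d
                     o-z = step c o-x
                 in (i-d , From-≤ (m≤m+n 5 3) o-d , inj₂ (From-≤ (m≤m+n 5 1) o-d))
                  ∷ (To-≤ (m≤m+n 7 1) i-x , From-≤ (m≤m+n 6 2) o-x , inj₂ o-x)
                  ∷ (To-≤ (m≤m+n 6 2) i-z , From-≤ (m≤m+n 7 1) o-z , inj₁ i-z) ∷ [] }))
      ear₃ {x} {z} {u} e-dx x∉ e-xz z∉ d≢z e-zu u∈ (inj₂ o) =
        pick (there (there (here refl))) (ear Tame Tame-⊑ s tame (E-sym e-zu ◂ E-sym e-xz ◂ E-sym e-dx ◂ end e-dy) u∈ y∈ (z∉ ∷ x∉ ∷ d∉ ∷ [])
               ((E⇒≢ (E-sym e-xz) ∷ (d≢z ∘ sym) ∷ []) ∷ (E⇒≢ (E-sym e-dx) ∷ []) ∷ [] ∷ []) (inj₂ λ ())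
               (λ { t e (a ◂ b ◂ c ◂ end f) →
                 let o-z = step a (O-⊑ e o)
                     o-x = step b o-z
                     o-d = step c o-x
                     i-d = step f (I-⊑ e (proj₁ (proj₂ hub)))
                     i-x = step c i-d
                     i-z = step b i-x
                 in (To-≤ (m≤m+n 7 1) i-z , From-≤ (m≤m+n 6 2) o-z , inj₂ o-z)
                  ∷ (To-≤ (m≤m+n 6 2) i-x , From-≤ (m≤m+n 7 1) o-x , inj₁ i-x)
                  ∷ (To-≤ (m≤m+n 5 3) i-d , o-d , inj₁ (To-≤ (m≤m+n 5 1) i-d)) ∷ [] }))

      ear₄ : ∀ {x z f u} → E d x → x ∉ verts s → E x z → z ∉ verts s → d ≢ z →
             E z f → f ∉ verts s → d ≢ f → x ≢ f → E f u → Hub s u → Covered s d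
      ear₄ {x} {z} {f} {u} e-dx x∉ e-xz z∉ d≢z e-zf f∉ d≢f x≢f e-fu (u∈ , i , _) =
        pick (here refl) (ear Tame Tame-⊑ s tame (E-sym e-dy ◂ e-dx ◂ e-xz ◂ e-zf ◂ end e-fu) y∈ u∈ (d∉ ∷ x∉ ∷ z∉ ∷ f∉ ∷ [])
               ((E⇒≢ e-dx ∷ d≢z ∷ d≢f ∷ []) ∷ (E⇒≢ e-xz ∷ x≢f ∷ []) ∷ (E⇒≢ e-zf ∷ []) ∷ [] ∷ []) (inj₂ λ ())
               (λ { t e (a ◂ b ◂ c ◂ g ◂ end h) →
                 let i-f = step h (I-⊑ e i)
                     i-z = step g i-f
                     i-x = step c i-z
                     i-d = step b i-x
                     o-d = step a (O-⊑ e (proj₂ (proj₂ hub)))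
                     o-x = step b o-d
                     o-z = step c o-x
                     o-f = step g o-z
                 in (i-d , From-≤ (m≤m+n 5 3) o-d , inj₂ (From-≤ (m≤m+n 5 1) o-d))
                  ∷ (To-≤ (m≤m+n 7 1) i-x , From-≤ (m≤m+n 6 2) o-x , inj₂ o-x)
                  ∷ (To-≤ (m≤m+n 6 2) i-z , From-≤ (m≤m+n 7 1) o-z , inj₁ i-z)
                  ∷ (To-≤ (m≤m+n 5 3) i-f , o-f , inj₁ (To-≤ (m≤m+n 5 1) i-f)) ∷ [] }))

    Covered-⊑ : ∀ {s t d} → s ⊑ t → Covered t d → Covered s d
    Covered-⊑ s⊑t (u , t⊑u , c) = u , ⊑-trans s⊑t t⊑u , c

    -- A shortest cycle through dy in the contraction of s is found along any walk from d to y that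
    -- avoids the edge dy: until a cycle of length ≤ 5 shows up, the walk stays at distance ≤ 1 from d.
    module _ (s : Partial E) (tame : AllTame s) (reach : ∀ w → Reachable s w)
             {d y : Fin n} (d∉ : d ∉ verts s) (e-dy : E d y) (hub : Hub s y) where

      walk-from-d : ∀ {k} → Walk (Avoiding E d y) d y k → Covered s d
      walk-from-x : ∀ {x k} → x ∉ verts s → E d x → Walk (Avoiding E d y) x y k → Covered s d

      walk-from-d here = contradiction (proj₁ hub) d∉
      walk-from-d (step {w = u} (e-du , ≢dy , _) w) with u ∈? verts s
      ... | yes u∈ = ear₁ s tame d∉ e-dy hub e-du u∈ (λ u≡y → ≢dy (refl , u≡y))
      ... | no  u∉ = walk-from-x u∉ e-du w

      walk-from-x x∉ e-dx here = contradiction (proj₁ hub) x∉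
      walk-from-x {x} x∉ e-dx (step {w = u} (e-xu , _) w) with reach x
      ... | inj₁ x∈ = contradiction x∈ x∉
      ... | inj₂ (inj₁ (v , e-xv , v∈ , _)) = ear₂ s tame d∉ e-dy hub e-dx x∉ e-xv v∈
      ... | inj₂ (inj₂ (d′ , y′ , e-xd′ , e-d′y′ , hub′)) with d′ ∈? verts s | d′ ≟ᶠ d
      ...   | yes d′∈ | _ = ear₂ s tame d∉ e-dy hub e-dx x∉ e-xd′ d′∈
      ...   | no d′∉ | no d′≢d =
        ear₃ s tame d∉ e-dy hub e-dx x∉ e-xd′ d′∉ (d′≢d ∘ sym) e-d′y′ (proj₁ hub′) (inj₁ (To-≤ (m≤m+n 4 1) (proj₁ (proj₂ hub′))))
      -- The route of x to a hub passes through d itself and closes no new cycle, so the next vertex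
      -- u of the walk is examined.
      ...   | no d′∉ | yes _ with u ∈? verts s | u ≟ᶠ d
      ...     | yes u∈ | _        = ear₂ s tame d∉ e-dy hub e-dx x∉ e-xu u∈
      ...     | no u∉  | yes refl = walk-from-d w
      ...     | no u∉  | no u≢d with reach u
      ...       | inj₁ u∈ = contradiction u∈ u∉
      ...       | inj₂ (inj₁ (v , e-uv , v∈ , io)) = ear₃ s tame d∉ e-dy hub e-dx x∉ e-xu u∉ (u≢d ∘ sym) e-uv v∈ io
      ...       | inj₂ (inj₂ (f , y″ , e-uf , e-fy″ , hub″)) with f ∈? verts s | f ≟ᶠ d | f ≟ᶠ x
      -- Now u is adjacent to d and takes over the role of x.
      ...         | no f∉ | yes refl | _ = walk-from-x u∉ (E-sym e-uf) w
      ...         | no f∉ | no f≢d | yes refl = ear₂ s tame d∉ e-dy hub e-dx x∉ e-fy″ (proj₁ hub″)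
      ...         | no f∉ | no f≢d | no f≢x =
        ear₄ s tame d∉ e-dy hub e-dx x∉ e-xu u∉ (u≢d ∘ sym) e-uf f∉ (f≢d ∘ sym) (f≢x ∘ sym) e-fy″ hub″
      -- f is already covered and adjacent to a hub: orienting that edge brings f within 5 on one side.
      ...         | yes f∈ | _ | _ with orientEdge s e-fy″ f∈ (proj₁ hub″)
      ...           | t , s⊑t , vs≡ , a =
        Covered-⊑ s⊑t (ear₃ t (λ v∈ → Tame-⊑ s⊑t (tame (subst (_ ∈_) vs≡ v∈))) (∉t d∉) e-dy (Hub-⊑ s⊑t hub)
          e-dx (∉t x∉) e-xu (∉t u∉) (u≢d ∘ sym) e-uf (verts⊆ s⊑t f∈) (short a))
        where
        ∉t : ∀ {v} → v ∉ verts s → v ∉ verts t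
        ∉t v∉ v∈ = v∉ (subst (_ ∈_) vs≡ v∈)
        short : Arc t f y″ ⊎ Arc t y″ f → I t f 5 ⊎ O t f 5
        short (inj₁ b) = inj₁ (step b (I-⊑ s⊑t (proj₁ (proj₂ hub″))))
        short (inj₂ b) = inj₂ (step b (O-⊑ s⊑t (proj₂ (proj₂ hub″))))

    -- The last layer: attaching the neighbours of a base

    Layered : ℕ → Partial E → Fin n → Set
    Layered t s v = I s v (2 + t) × O s v (2 + t) × (I s v (1 + t) ⊎ O s v (1 + t))

    Layered-⊑ : ∀ {t s s′ v} → s ⊑ s′ → Layered t s v → Layered t s′ v
    Layered-⊑ s⊑t (i , o , inj₁ i′) = I-⊑ s⊑t i , O-⊑ s⊑t o , inj₁ (I-⊑ s⊑t i′)
    Layered-⊑ s⊑t (i , o , inj₂ o′) = I-⊑ s⊑t i , O-⊑ s⊑t o , inj₂ (O-⊑ s⊑t o′)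

    Base : ℕ → Partial E → Fin n → Set
    Base t s v = v ∈ verts s × I s v t × O s v t

    Base-⊑ : ∀ {t s s′ v} → s ⊑ s′ → Base t s v → Base t s′ v
    Base-⊑ s⊑t (v∈ , i , o) = verts⊆ s⊑t v∈ , I-⊑ s⊑t i , O-⊑ s⊑t o

    -- With one inner vertex, the one-sided 1 + t at x is enough for 2 + t. With two inner vertices
    -- both ends are base vertices, and they may coincide.
    attach : ∀ {t} (s : Partial E) → (∀ {v} → v ∈ verts s → Layered t s v) → ∀ {d y x} → d ∉ verts s →
      E d y → Base t s y → E d x → x ≢ y → x ∈ verts s ⊎ ∃[ z ] (E x z × Base t s z) →
      ∃[ s′ ] (s ⊑ s′ × (∀ {v} → v ∈ verts s′ → Layered t s′ v) × d ∈ verts s′)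
    attach {t} s inv {d} {y} {x} d∉ e-dy (y∈ , i-y , o-y) e-dx x≢y other with x ∈? verts s
    attach {t} s inv {d} {y} {x} d∉ e-dy (y∈ , i-y , o-y) e-dx x≢y other | yes x∈ with proj₂ (proj₂ (inv x∈))
    ... | inj₁ i =
      pick (here refl) (ear (Layered t) Layered-⊑ s inv (E-sym e-dy ◂ end e-dx) y∈ x∈ (d∉ ∷ []) ([] ∷ []) (inj₁ (x≢y ∘ sym))
             (λ { s′ e (a ◂ end b) → let o-d = step a (O-⊑ e o-y) in
                (step b (I-⊑ e i) , From-≤ (n≤1+n _) o-d , inj₂ o-d) ∷ [] }))
    attach {t} s inv {d} {y} {x} d∉ e-dy (y∈ , i-y , o-y) e-dx x≢y other | yes x∈ | inj₂ o =
      pick (here refl) (ear (Layered t) Layered-⊑ s inv (E-sym e-dx ◂ end e-dy) x∈ y∈ (d∉ ∷ []) ([] ∷ []) (inj₁ x≢y)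
             (λ { s′ e (a ◂ end b) → let i-d = step b (I-⊑ e i-y) in
                (To-≤ (n≤1+n _) i-d , step a (O-⊑ e o) , inj₁ i-d) ∷ [] }))
    attach s inv d∉ e-dy b e-dx x≢y (inj₁ x∈) | no x∉ = contradiction x∈ x∉
    attach {t} s inv {d} {y} {x} d∉ e-dy (y∈ , i-y , o-y) e-dx x≢y (inj₂ (z , e-xz , z∈ , i-z , o-z)) | no x∉ =
      pick (here refl) (ear (Layered t) Layered-⊑ s inv (E-sym e-dy ◂ e-dx ◂ end e-xz) y∈ z∈ (d∉ ∷ x∉ ∷ [])
             ((E⇒≢ e-dx ∷ []) ∷ [] ∷ []) (inj₂ λ ())
             (λ { s′ e (a ◂ b ◂ end c) →
                let o-d = step a (O-⊑ e o-y)
                    i-x = step c (I-⊑ e i-z)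
                in (step b i-x , From-≤ (n≤1+n _) o-d , inj₂ o-d)
                 ∷ (To-≤ (n≤1+n _) i-x , step b o-d , inj₁ i-x) ∷ [] }))

    complete : (∀ {u v} → E u v → ∃[ k ] Walk (Avoiding E u v) u v k) →
      (s : Partial E) → AllTame s → (∀ w → Reachable s w) → ∃[ t ] (s ⊑ t × (∀ v → I t v 10 × O t v 10))
    complete bridgeless s tame reach
      with coverAll (λ t → s ⊑ t × AllTame t) (λ t w → w ∈ verts t ⊎ ∃[ y ] (E w y × y ∈ verts t))
             (λ { e (inj₁ v∈) → inj₁ (verts⊆ e v∈) ; e (inj₂ (y , a , y∈)) → inj₂ (y , a , verts⊆ e y∈) })
             next s (⊑-refl , tame)
      where
      next : ∀ t → s ⊑ t × AllTame t → ∀ w →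
             ∃[ u ] (t ⊑ u × (s ⊑ u × AllTame u) × (w ∈ verts u ⊎ ∃[ y ] (E w y × y ∈ verts u)))
      next t (s⊑t , tame-t) w with Reachable-⊑ s⊑t (reach w)
      ... | inj₁ w∈ = t , ⊑-refl , (s⊑t , tame-t) , inj₁ w∈
      ... | inj₂ (inj₁ (y , e , y∈ , _)) = t , ⊑-refl , (s⊑t , tame-t) , inj₂ (y , e , y∈)
      ... | inj₂ (inj₂ (d , y , e-wd , e-dy , hub)) with d ∈? verts t
      ...   | yes d∈ = t , ⊑-refl , (s⊑t , tame-t) , inj₂ (d , e-wd , d∈)
      -- Absorbing the middle vertex d is enough: w is then adjacent to the core.
      ...   | no  d∉ with walk-from-d t tame-t (λ v → Reachable-⊑ s⊑t (reach v)) d∉ e-dy hub (proj₂ (bridgeless e-dy))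
      ...     | u , t⊑u , tame-u , d∈ = u , t⊑u , (⊑-trans s⊑t t⊑u , tame-u) , inj₂ (d , e-wd , d∈)
    ... | s₁ , s⊑s₁ , (_ , tame₁) , dominated
      with coverAll (λ t → s₁ ⊑ t × (∀ {v} → v ∈ verts t → Layered 8 t v)) (λ t w → w ∈ verts t)
             (λ e v∈ → verts⊆ e v∈) next s₁
             (⊑-refl , λ v∈ → let i , o , _ = tame₁ v∈ in To-≤ (m≤m+n 8 2) i , From-≤ (m≤m+n 8 2) o , inj₁ (To-≤ (m≤m+n 8 1) i))
      where
      -- Bases come from s₁ and never from vertices added in this phase, so the cost of two does not
      -- accumulate.
      base : ∀ {t y} → s₁ ⊑ t → y ∈ verts s₁ → Base 8 t y
      base s₁⊑t y∈ = let i , o , _ = tame₁ y∈ in Base-⊑ s₁⊑t (y∈ , i , o)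
      next : ∀ t → s₁ ⊑ t × (∀ {v} → v ∈ verts t → Layered 8 t v) → ∀ w →
             ∃[ u ] (t ⊑ u × (s₁ ⊑ u × (∀ {v} → v ∈ verts u → Layered 8 u v)) × w ∈ verts u)
      next t (s₁⊑t , inv) w with w ∈? verts t
      ... | yes w∈ = t , ⊑-refl , (s₁⊑t , inv) , w∈
      ... | no  w∉ with dominated w
      ...   | inj₁ w∈ = contradiction (verts⊆ s₁⊑t w∈) w∉
      ...   | inj₂ (y , e-wy , y∈) with bridgeless e-wy
      ...     | _ , here = contradiction e-wy E-irrefl
      ...     | _ , step {w = x} (e-wx , ≢wy , _) _
        with attach t inv w∉ e-wy (base s₁⊑t y∈) e-wx (λ x≡y → ≢wy (refl , x≡y)) (other (dominated x))
        where
        other : x ∈ verts s₁ ⊎ ∃[ y ] (E x y × y ∈ verts s₁) → x ∈ verts t ⊎ ∃[ z ] (E x z × Base 8 t z)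
        other (inj₁ x∈)             = inj₁ (verts⊆ s₁⊑t x∈)
        other (inj₂ (z , e-xz , z∈)) = inj₂ (z , e-xz , base s₁⊑t z∈)
      ...       | u , t⊑u , inv-u , w∈ = u , t⊑u , (⊑-trans s₁⊑t t⊑u , inv-u) , w∈
    ...   | s₂ , s₁⊑s₂ , (_ , inv₂) , all∈ =
      s₂ , ⊑-trans s⊑s₁ s₁⊑s₂ , λ v → proj₁ (inv₂ (all∈ v)) , proj₁ (proj₂ (inv₂ (all∈ v)))

-- Distances and the two sides of an edge

least : {P : ℕ → Set} → (∀ k → Dec (P k)) → ∀ m → P m → ∃[ k ] (k ≤ m × P k × (∀ {j} → P j → k ≤ j))
least P? zero    pm = 0 , z≤n , pm , λ _ → z≤n
least P? (suc m) pm with P? 0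
... | yes p₀ = 0 , z≤n , p₀ , λ _ → z≤n
... | no ¬p₀ with least (P? ∘ suc) m pm
...   | k , k≤m , pk , min = suc k , s≤s k≤m , pk , λ { {zero} p₀ → contradiction p₀ ¬p₀ ; {suc j} pj → s≤s (min pj) }

Walk-reverse : {R : Fin n → Fin n → Set} → (∀ {u v} → R u v → R v u) → ∀ {u v w j k} →
  Walk R u v j → Walk R u w k → Walk R v w (j + k)
Walk-reverse R-sym here acc = acc
Walk-reverse {R = R} R-sym {k = k} (step {k = j} r w) acc =
  subst (Walk R _ _) (+-suc j k) (Walk-reverse R-sym w (step (R-sym r) acc))

Walk-map : {R Q : Fin n → Fin n → Set} → (∀ {u v} → R u v → Q u v) → ∀ {u v k} → Walk R u v k → Walk Q u v k
Walk-map f here       = here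
Walk-map f (step r w) = step (f r) (Walk-map f w)

module Metric {n : ℕ} (E : Fin n → Fin n → Set) (E? : ∀ u v → Dec (E u v)) (E-sym : ∀ {u v} → E u v → E v u)
              (E-irrefl : ∀ {u} → ¬ E u u) (diam : DiamLe E 4) where

  open Extension E E-sym E-irrefl public

  Within : (Fin n → Set) → ℕ → Fin n → Set
  Within T zero    w = T w
  Within T (suc k) w = T w ⊎ ∃[ u ] (E w u × Within T k u)

  within? : {T : Fin n → Set} → (∀ v → Dec (T v)) → ∀ k w → Dec (Within T k w)
  within? T? zero    w = T? w
  within? T? (suc k) w = T? w ⊎-dec any? λ u → E? w u ×-dec within? T? k u

  Walk⇒Within : ∀ {T w z m k} → Walk E w z m → m ≤ k → T z → Within T k w
  Walk⇒Within {k = zero}  here _ t = t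
  Walk⇒Within {k = suc k} here _ t = inj₁ t
  Walk⇒Within (step e w) (s≤s m≤k) t = inj₂ (_ , e , Walk⇒Within w m≤k t)

  Within⇒Walk : ∀ {T w} k → Within T k w → ∃[ z ] ∃[ m ] (Walk E w z m × m ≤ k × T z)
  Within⇒Walk zero    t        = _ , 0 , here , z≤n , t
  Within⇒Walk (suc k) (inj₁ t) = _ , 0 , here , z≤n , t
  Within⇒Walk (suc k) (inj₂ (u , e , r)) with Within⇒Walk k r
  ... | z , m , w , m≤k , t = z , suc m , step e w , s≤s m≤k , t

  abstract
    nearest : ∀ r v → ∃[ k ] (k ≤ 4 × Within (_≡ r) k v × (∀ {j} → Within (_≡ r) j v → k ≤ j))
    nearest r v = let m , m≤4 , w = diam v r
                      k , k≤m , r , min = least (λ k → within? (_≟ᶠ r) k v) m (Walk⇒Within w ≤-refl refl)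
                  in k , ≤-trans k≤m m≤4 , r , min

  dist : Fin n → Fin n → ℕ
  dist r v = proj₁ (nearest r v)

  dist≤4 : ∀ r v → dist r v ≤ 4
  dist≤4 r v = proj₁ (proj₂ (nearest r v))

  dist-walk : ∀ {r v m} → Walk E v r m → dist r v ≤ m
  dist-walk {r} {v} w = proj₂ (proj₂ (proj₂ (nearest r v))) (Walk⇒Within w ≤-refl refl)

  dist-self : ∀ {r} → dist r r ≡ 0
  dist-self = n≤0⇒n≡0 (dist-walk here)

  dist-edge : ∀ {r u v} → E u v → dist r u ≤ suc (dist r v)
  dist-edge {r} {u} {v} e =
    proj₂ (proj₂ (proj₂ (nearest r u))) {suc (dist r v)} (inj₂ (v , e , proj₁ (proj₂ (proj₂ (nearest r v)))))

  dist≡0 : ∀ {r v} → dist r v ≡ 0 → v ≡ r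
  dist≡0 {r} {v} d≡0 = subst (λ k → Within (_≡ r) k v) d≡0 (proj₁ (proj₂ (proj₂ (nearest r v))))

  dist⇒Within : ∀ {T r v k} → dist r v ≤ k → T r → Within T k v
  dist⇒Within {T} {r} {v} d≤k t with Within⇒Walk (dist r v) (proj₁ (proj₂ (proj₂ (nearest r v))))
  ... | z , m , w , m≤d , refl = Walk⇒Within w (≤-trans m≤d d≤k) t

  closer : ∀ {r v k} → dist r v ≡ suc k → ∃[ u ] (E v u × dist r u ≡ k)
  closer {r} {v} {k} d≡ with subst (λ k → Within (_≡ r) k v) d≡ (proj₁ (proj₂ (proj₂ (nearest r v))))
  ... | inj₁ refl = contradiction (trans (sym dist-self) d≡) λ ()
  ... | inj₂ (u , e , near) = u , e ,
    ≤-antisym (proj₂ (proj₂ (proj₂ (nearest r u))) near)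
              (s≤s⁻¹ (≤-trans (≤-reflexive (sym d≡)) (dist-edge e)))

  dist≡1 : ∀ {r v} → dist r v ≡ 1 → E v r
  dist≡1 {r} {v} d≡1 with closer d≡1
  ... | u , e , d≡0 = subst (E v) (dist≡0 d≡0) e

  crossing : {T : Fin n → Set} → (∀ v → Dec (T v)) → {R : Fin n → Fin n → Set} → ∀ {w z m} →
    Walk R w z m → ¬ T w → T z →
    ∃[ y ] ∃[ x ] ∃[ i ] ∃[ j ] (¬ T y × T x × R y x × Walk R w y i × Walk R x z j × m ≡ i + suc j)
  crossing T? here ¬t t = contradiction t ¬t
  crossing T? (step {w = u} r w) ¬t t with T? u
  ... | yes tu = _ , u , 0 , _ , ¬t , tu , r , here , w , refl
  ... | no ¬tu with crossing T? w ¬tu t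
  ...   | y , x , i , j , ¬ty , tx , r′ , w₁ , w₂ , m≡ = y , x , suc i , j , ¬ty , tx , r′ , step r w₁ , w₂ , cong suc m≡

  module Sides (p q : Fin n) where

    dp dq : Fin n → ℕ
    dp = dist p
    dq = dist q

    PSide QSide : Fin n → Set
    PSide v = dp v < dq v
    QSide v = dq v ≤ dp v

    PSide? : ∀ v → Dec (PSide v)
    PSide? v = dp v <? dq v

    QSide? : ∀ v → Dec (QSide v)
    QSide? v = dq v ≤? dp v

    dp≤3 : ∀ {v} → PSide v → dp v ≤ 3
    dp≤3 {v} lt = s≤s⁻¹ (≤-trans lt (dist≤4 q v))

    -- A step changes each distance by at most one, so lowering `dp` by one preserves `dp` < `dq`.
    -- Shortest paths to p thus stay on the p-side, and likewise those to q on the q-side.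
    PSide-closer : ∀ {v k} → PSide v → dp v ≡ suc k → ∃[ u ] (E v u × dp u ≡ k × PSide u)
    PSide-closer {v} {k} lt d≡ with closer d≡
    ... | u , e , du≡ = u , e , du≡ , (begin
      suc (dp u) ≡⟨ cong suc du≡ ⟩
      suc k      ≡⟨ d≡ ⟨
      dp v       ≤⟨ s≤s⁻¹ (≤-trans lt (dist-edge e)) ⟩
      dq u       ∎)
      where open ≤-Reasoning

    QSide-closer : ∀ {v k} → QSide v → dq v ≡ suc k → ∃[ u ] (E v u × dq u ≡ k × QSide u)
    QSide-closer {v} {k} ge d≡ with closer d≡
    ... | u , e , du≡ = u , e , du≡ , (begin
      dq u ≡⟨ du≡ ⟩
      k    ≤⟨ s≤s⁻¹ (≤-trans (≤-reflexive (sym d≡)) (≤-trans ge (dist-edge e))) ⟩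
      dp u ∎)
      where open ≤-Reasoning

    next-to-p : (∀ {v} → E v p → ¬ E v q) → ∀ {v} → dp v ≡ 1 → v ≡ q ⊎ PSide v
    next-to-p no-triangle {v} dp≡1 = by (dq v) refl
      where
      by : ∀ k → dq v ≡ k → v ≡ q ⊎ PSide v
      by 0 dq≡ = inj₁ (dist≡0 dq≡)
      by 1 dq≡ = contradiction (dist≡1 dq≡) (no-triangle (dist≡1 dp≡1))
      by (suc (suc k)) dq≡ = inj₂ (≤-trans (≤-reflexive (cong suc dp≡1)) (≤-trans (s≤s (s≤s z≤n)) (≤-reflexive (sym dq≡))))

    -- Ears run from q through the q-side, cross over once, and return through the p-side to p. Along
    -- them ψ-out increases and ψ-in decreases, so these potentials bound the out- and in-distances.
    -- The slack c is 0 when starting from p → q alone, and 2 when starting from all neighbours of p and q.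
    module Ears (c δ : ℕ) (X : Fin n → Fin n → Set) (X-from-q : ∀ {u v} → E u v → QSide u → X u v)
                (X-into-p : ∀ {u v} → E u v → PSide v → X u v) where

      -- The 8 is 4 + 1 + 3: the q-side extends to distance 4, the p-side only to 3, and even a
      -- crossing arc between these extremes must lower `ψ-in` and raise `ψ-out`.
      ψ-in ψ-out : Fin n → ℕ
      ψ-in  v = if does (PSide? v) then dp v + c else 8 + c ∸ dq v
      ψ-out v = if does (PSide? v) then 8 + c ∸ dp v else dq v + c

      ψ-in-p : ∀ {v} → PSide v → ψ-in v ≡ dp v + c
      ψ-in-p {v} lt rewrite dec-true (PSide? v) lt = refl

      ψ-in-q : ∀ {v} → QSide v → ψ-in v ≡ 8 + c ∸ dq v
      ψ-in-q {v} ge rewrite dec-false (PSide? v) (≤⇒≯ ge) = refl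

      ψ-out-p : ∀ {v} → PSide v → ψ-out v ≡ 8 + c ∸ dp v
      ψ-out-p {v} lt rewrite dec-true (PSide? v) lt = refl

      ψ-out-q : ∀ {v} → QSide v → ψ-out v ≡ dq v + c
      ψ-out-q {v} ge rewrite dec-false (PSide? v) (≤⇒≯ ge) = refl

      record _↘_ (u v : Fin n) : Set where
        constructor falls
        field
          in<  : ψ-in v < ψ-in u
          out< : ψ-out u < ψ-out v
      open _↘_

      private
        gap : ∀ {a k} → a ≤ 8 → a ≡ suc k → suc (8 + c ∸ a) ≡ 8 + c ∸ k
        gap {a} {k} a≤8 refl = sym (+-∸-assoc 1 {7 + c} {k} (≤-trans (s≤s⁻¹ a≤8) (m≤m+n 7 c)))

        far : ∀ {a} k → k ≤ 8 → a ≤ k → 8 ∸ k + c ≤ 8 + c ∸ a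
        far {a} k k≤8 a≤k = ≤-trans (≤-reflexive (sym (+-∸-comm c k≤8))) (∸-monoʳ-≤ (8 + c) a≤k)

      ↘-q : ∀ {u v} → QSide u → QSide v → dq v ≡ suc (dq u) → u ↘ v
      ↘-q {u} {v} gu gv d≡ = falls
        (≤-reflexive (trans (cong suc (ψ-in-q gv)) (trans (gap (≤-trans (dist≤4 q v) (m≤m+n 4 4)) d≡) (sym (ψ-in-q gu)))))
        (≤-reflexive (trans (cong suc (ψ-out-q gu)) (trans (cong (_+ c) (sym d≡)) (sym (ψ-out-q gv)))))

      ↘-p : ∀ {u v} → PSide u → PSide v → dp u ≡ suc (dp v) → u ↘ v
      ↘-p {u} {v} lu lv d≡ = falls
        (≤-reflexive (trans (cong suc (ψ-in-p lv)) (trans (cong (_+ c) (sym d≡)) (sym (ψ-in-p lu)))))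
        (≤-reflexive (trans (cong suc (ψ-out-p lu)) (trans (gap (≤-trans (dist≤4 p u) (m≤m+n 4 4)) d≡) (sym (ψ-out-p lv)))))

      ↘-cross : ∀ {u v} → QSide u → PSide v → u ↘ v
      ↘-cross {u} {v} gu lv = falls
        (≤-trans (≤-reflexive (cong suc (ψ-in-p lv)))
          (≤-trans (≤-trans (s≤s (+-monoˡ-≤ c (dp≤3 lv))) (far 4 (m≤m+n 4 4) (dist≤4 q u))) (≤-reflexive (sym (ψ-in-q gu)))))
        (≤-trans (≤-reflexive (cong suc (ψ-out-q gu)))
          (≤-trans (≤-trans (s≤s (+-monoˡ-≤ c (dist≤4 q u))) (far 3 (m≤m+n 3 5) (dp≤3 lv))) (≤-reflexive (sym (ψ-out-p lv)))))

      I O : Partial X → Fin n → ℕ → Set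
      I = In p q δ
      O = Out p q δ

      Graded : Partial X → Fin n → Set
      Graded s v = I s v (ψ-in v) × O s v (ψ-out v) × I s v 8 × O s v 8

      Graded-⊑ : ∀ {s t v} → s ⊑ t → Graded s v → Graded t v
      Graded-⊑ e (i , o , i′ , o′) =
        To-⊆ (arcs⊆ e) ≤-refl i , From-⊆ (arcs⊆ e) ≤-refl o , To-⊆ (arcs⊆ e) ≤-refl i′ , From-⊆ (arcs⊆ e) ≤-refl o′

      record Grown (s : Partial X) : Set where
        constructor grown
        field
          graded : ∀ {v} → v ∈ verts s → Graded s v
          p∈     : p ∈ verts s
          q∈     : q ∈ verts s
          outer  : ∀ {v} → v ∉ verts s → c ≤ dp v × c ≤ dq v
      open Grown public

      Grown-⊑ : ∀ {s t} → s ⊑ t → Grown s → (∀ {v} → v ∈ verts t → Graded t v) → Grown t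
      Grown-⊑ e g gr = grown gr (verts⊆ e (p∈ g)) (verts⊆ e (q∈ g)) (λ v∉ → outer g (v∉ ∘ verts⊆ e))

      -- Uncovered vertices are at distance between c and 4 from both roots. So c is at most 4 where
      -- it is added to a distance, and it is cancelled in 8 + c minus a distance.
      ψ≤8 : ∀ {s v} → Grown s → v ∉ verts s → ψ-in v ≤ 8 × ψ-out v ≤ 8
      ψ≤8 {s} {v} g v∉ with PSide? v | outer g v∉
      ... | yes lt | c≤dp , c≤dq =
        ≤-trans (≤-reflexive (ψ-in-p lt)) (+-mono-≤ (dist≤4 p v) (≤-trans c≤dp (dist≤4 p v))) ,
        ≤-trans (≤-reflexive (ψ-out-p lt)) (≤-trans (∸-monoʳ-≤ (8 + c) c≤dp) (≤-reflexive (m+n∸n≡m 8 c)))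
      ... | no ¬lt | c≤dp , c≤dq =
        ≤-trans (≤-reflexive (ψ-in-q (≮⇒≥ ¬lt))) (≤-trans (∸-monoʳ-≤ (8 + c) c≤dq) (≤-reflexive (m+n∸n≡m 8 c))) ,
        ≤-trans (≤-reflexive (ψ-out-q (≮⇒≥ ¬lt))) (+-mono-≤ (dist≤4 q v) (≤-trans c≤dq (dist≤4 q v)))

      -- `land` accepts any proven in-bound m in place of `ψ-in g`: a detour below lands at a vertex
      -- whose potential is too large although its in-distance is small.
      data Descent (s : Partial X) : Fin n → List (Fin n) → Fin n → Set where
        land : ∀ {v g m} → X v g → g ∈ verts s → I s g m → m < ψ-in v → Descent s v [] g
        fall : ∀ {v w l g} → X v w → v ↘ w → w ∉ verts s → Descent s w l g → Descent s v (w ∷ l) g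

      module _ {s : Partial X} where

        link : ∀ {v l g} → Descent s v l g → Link X v l g
        link (land x _ _ _) = end x
        link (fall x _ _ d) = x ◂ link d

        target∈ : ∀ {v l g} → Descent s v l g → g ∈ verts s
        target∈ (land _ g∈ _ _) = g∈
        target∈ (fall _ _ _ d)  = target∈ d

        new : ∀ {v l g} → Descent s v l g → All (_∉ verts s) l
        new (land _ _ _ _)  = []
        new (fall _ _ w∉ d) = w∉ ∷ new d

        below : ∀ {v l g} → Descent s v l g → All (λ w → ψ-in w < ψ-in v) l
        below (land _ _ _ _) = []
        below (fall _ f _ d) = in< f ∷ All.map (λ lt → <-trans lt (in< f)) (below d)

        unique : ∀ {v l g} → Descent s v l g → Unique (v ∷ l)
        unique d@(land _ _ _ _)  = [] ∷ []
        unique d@(fall _ _ _ d′) = All.map (λ { lt refl → <-irrefl refl lt }) (below d) ∷ unique d′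

        ins : ∀ {v l g t} → s ⊑ t → Descent s v l g → Link (Arc t) v l g → All (λ w → I t w (ψ-in w)) (v ∷ l)
        ins e (land _ _ i lt) (end a)  = To-≤ lt (step a (To-⊆ (arcs⊆ e) ≤-refl i)) ∷ []
        ins e (fall _ f _ d) (a ◂ lk) with ins e d lk
        ... | i ∷ is = To-≤ (in< f) (step a i) ∷ i ∷ is

        outs : ∀ {v l g t} → O t v (ψ-out v) → Descent s v l g → Link (Arc t) v l g → All (λ w → O t w (ψ-out w)) l
        outs o (land _ _ _ _) (end _)  = []
        outs {t = t} o (fall _ f _ d) (a ◂ lk) = let o′ = From-≤ (out< f) (step a o) in o′ ∷ outs {t = t} o′ d lk

      Growth : Partial X → Fin n → List (Fin n) → Fin n → Set
      Growth s v l g = ∃[ t ] (s ⊑ t × Grown t × Link (Arc t) v l g)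

      -- The last hypothesis keeps the ear from ending where it starts: `ψ-out` rises strictly from
      -- u to v, so u is not g.
      launch : ∀ {s} → Grown s → ∀ {u v l g} → u ∈ verts s → Descent s u (v ∷ l) g → ψ-out v ≤ ψ-out g →
        Growth s u (v ∷ l) g
      launch {s} gr {u} {v} {l} {g} u∈ d@(fall x f v∉ d′) ψv≤ψg
        with insertEar s (link d) u∈ (target∈ d) (new d) (unique d′) (inj₁ λ { refl → <⇒≱ (out< f) ψv≤ψg })
      ... | t , e , lk@(a ◂ lk′) , vs≡ = t , e , Grown-⊑ e gr graded′ , lk
        where
        new∈ : ∀ {w} → w ∈ v ∷ l → Graded t w
        new∈ w∈ = let i = All.lookup (ins e d′ lk′) w∈
                      o = All.lookup (outs {t = t} (From-⊆ (arcs⊆ e) ≤-refl (proj₁ (proj₂ (graded gr u∈)))) d lk) w∈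
                      i≤ , o≤ = ψ≤8 gr (All.lookup (new d) w∈)
                  in i , o , To-≤ i≤ i , From-≤ o≤ o
        graded′ : ∀ {w} → w ∈ verts t → Graded t w
        graded′ w∈ with ∈-++⁻ (v ∷ l) (subst (_ ∈_) vs≡ w∈)
        ... | inj₁ w∈l = new∈ w∈l
        ... | inj₂ w∈s = Graded-⊑ e (graded gr w∈s)

      -- The ear is assembled backwards: the vertices of a shortest path from v to q are put in
      -- front until a covered one is met, at the latest q.
      climb : ∀ {s} → Grown s → ∀ k {v l g} → dq v ≡ k → QSide v → v ∉ verts s → Descent s v l g → ψ-out v ≤ ψ-out g →
        Growth s v l g
      climb gr zero d≡ ge v∉ _ _ = contradiction (subst (_∈ _) (sym (dist≡0 d≡)) (q∈ gr)) v∉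
      climb {s} gr (suc k) d≡ ge v∉ d ψ≤ with QSide-closer ge d≡
      ... | u , e-vu , du≡ , ge-u with ↘-q ge-u ge (trans d≡ (cong suc (sym du≡))) | u ∈? verts s
      ...   | f | yes u∈ with launch gr u∈ (fall (X-from-q (E-sym e-vu) ge-u) f v∉ d) ψ≤
      ...     | t , e , gr′ , _ ◂ lk = t , e , gr′ , lk
      climb {s} gr (suc k) d≡ ge v∉ d ψ≤ | u , e-vu , du≡ , ge-u | f | no u∉
        with climb gr k du≡ ge-u u∉ (fall (X-from-q (E-sym e-vu) ge-u) f v∉ d) (≤-trans (<⇒≤ (out< f)) ψ≤)
      ... | t , e , gr′ , _ ◂ lk = t , e , gr′ , lk

      descend : ∀ {s} → Grown s → ∀ k {y} → dp y ≡ k → PSide y → y ∉ verts s →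
        ∃[ l ] ∃[ g ] (Descent s y l g × ψ-out y ≤ ψ-out g)
      descend gr zero d≡ lt y∉ = contradiction (subst (_∈ _) (sym (dist≡0 d≡)) (p∈ gr)) y∉
      descend {s} gr (suc k) d≡ lt y∉ with PSide-closer lt d≡
      ... | u , e-yu , du≡ , lt-u with ↘-p lt lt-u (trans d≡ (cong suc (sym du≡))) | u ∈? verts s
      ...   | f | yes u∈ = [] , u , land (X-into-p e-yu lt-u) u∈ (proj₁ (graded gr u∈)) (in< f) , <⇒≤ (out< f)
      ...   | f | no u∉ with descend gr k du≡ lt-u u∉
      ...     | l , g , d , ψ≤ = u ∷ l , g , fall (X-into-p e-yu lt-u) f u∉ d , ≤-trans (<⇒≤ (out< f)) ψ≤

      cross : ∀ {s} → Grown s → ∀ {x y} → E x y → QSide x → PSide y → x ∉ verts s ⊎ y ∉ verts s →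
        ∃[ t ] (s ⊑ t × Grown t × Arc t x y)
      cross {s} gr {x} {y} e-xy ge lt unc with ↘-cross ge lt | x ∈? verts s | y ∈? verts s
      ... | f | no x∉ | yes y∈ with climb gr _ refl ge x∉ (land (X-into-p e-xy lt) y∈ (proj₁ (graded gr y∈)) (in< f)) (<⇒≤ (out< f))
      ...   | t , e , gr′ , end a = t , e , gr′ , a
      cross {s} gr {x} {y} e-xy ge lt unc | f | x∈? | no y∉ with descend gr _ refl lt y∉
      ... | l , g , d , ψ≤ with x∈?
      ...   | yes x∈ with launch gr x∈ (fall (X-into-p e-xy lt) f y∉ d) ψ≤
      ...     | t , e , gr′ , a ◂ _ = t , e , gr′ , a
      cross {s} gr {x} {y} e-xy ge lt unc | f | x∈? | no y∉ | l , g , d , ψ≤ | no x∉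
        with climb gr _ refl ge x∉ (fall (X-into-p e-xy lt) f y∉ d) (≤-trans (<⇒≤ (out< f)) ψ≤)
      ... | t , e , gr′ , a ◂ _ = t , e , gr′ , a
      cross {s} gr e-xy ge lt unc | f | yes x∈ | yes y∈ = contradiction unc [ (λ x∉ → x∉ x∈) , (λ y∉ → y∉ y∈) ]′

-- Edges in no triangle or 4-cycle

DistLe-trans : {R : Fin n → Fin n → Set} → ∀ {u v w j k} → DistLe R u v j → DistLe R v w k → DistLe R u w (j + k)
DistLe-trans {R = R} (_ , i≤j , w₁) (_ , m≤k , w₂) = _ , +-mono-≤ i≤j m≤k , w₁ ++ʷ w₂
  where
  _++ʷ_ : ∀ {u v w i m} → Walk R u v i → Walk R v w m → Walk R u w (i + m)
  here     ++ʷ w = w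
  step r v ++ʷ w = step r (v ++ʷ w)

DistLe-≤ : {R : Fin n → Fin n → Set} → ∀ {u v j k} → j ≤ k → DistLe R u v j → DistLe R u v k
DistLe-≤ j≤k (m , m≤j , w) = m , ≤-trans m≤j j≤k , w

To⇒DistLe : ∀ {as : List (Fin n × Fin n)} {p q δ v k} → To as p q δ v k →
  DistLe (λ x y → (x , y) ∈ as) v p k ⊎ ∃[ m ] (m + δ ≤ k × DistLe (λ x y → (x , y) ∈ as) v q m)
To⇒DistLe at-p       = inj₁ (0 , z≤n , here)
To⇒DistLe (at-q δ≤k) = inj₂ (0 , δ≤k , 0 , z≤n , here)
To⇒DistLe (step a t) with To⇒DistLe t
... | inj₁ (m , m≤k , w)             = inj₁ (suc m , s≤s m≤k , step a w)
... | inj₂ (m , m≤k , j , j≤m , w) = inj₂ (suc m , s≤s m≤k , suc j , s≤s j≤m , step a w)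

snoc : {R : Fin n → Fin n → Set} → ∀ {u v w k} → DistLe R u v k → R v w → DistLe R u w (suc k)
snoc {k = k} d r = DistLe-≤ (≤-reflexive (+-comm k 1)) (DistLe-trans d (1 , ≤-refl , step r here))

From⇒DistLe : ∀ {as : List (Fin n × Fin n)} {p q δ v k} → From as p q δ v k →
  DistLe (λ x y → (x , y) ∈ as) q v k ⊎ ∃[ m ] (m + δ ≤ k × DistLe (λ x y → (x , y) ∈ as) p v m)
From⇒DistLe at-q       = inj₁ (0 , z≤n , here)
From⇒DistLe (at-p δ≤k) = inj₂ (0 , δ≤k , 0 , z≤n , here)
From⇒DistLe (step a t) with From⇒DistLe t
... | inj₁ d             = inj₁ (snoc d a)
... | inj₂ (m , m≤k , d) = inj₂ (suc m , s≤s m≤k , snoc d a)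

-- Only the combination u → q → p → v uses the path back from q to p. Its bounds are m + δ ≤ 10 and
-- k + δ ≤ 10, so the two δ pay for all but one of the 2δ + 1 steps.
rooted⇒DiamLe : ∀ {as : List (Fin n × Fin n)} {p q} δ → let R = λ x y → (x , y) ∈ as in
  DistLe R p q 1 → DistLe R q p (suc (δ + δ)) → (∀ v → To as p q δ v 10 × From as p q δ v 10) → DiamLe R 21
rooted⇒DiamLe δ pq qp near u v with To⇒DistLe (proj₁ (near u)) | From⇒DistLe (proj₂ (near v))
... | inj₁ up | inj₁ qv = DistLe-trans up (DistLe-trans pq qv)
... | inj₁ up | inj₂ (m , m≤ , pv) =
  DistLe-≤ (≤-trans (+-monoʳ-≤ 10 (≤-trans (m≤m+n m δ) m≤)) (m≤m+n 20 1)) (DistLe-trans up pv)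
... | inj₂ (m , m≤ , uq) | inj₁ qv =
  DistLe-≤ (≤-trans (+-monoˡ-≤ 10 (≤-trans (m≤m+n m δ) m≤)) (m≤m+n 20 1)) (DistLe-trans uq qv)
... | inj₂ (m , m≤ , uq) | inj₂ (k , k≤ , pv) =
  DistLe-≤ (≤-trans (≤-reflexive (regroup m δ k)) (s≤s (+-mono-≤ m≤ k≤))) (DistLe-trans uq (DistLe-trans qp pv))
  where
  regroup : ∀ m δ k → m + (suc (δ + δ) + k) ≡ suc ((m + δ) + (k + δ))
  regroup = solve 3 (λ m δ k → m :+ (con 1 :+ (δ :+ δ) :+ k) := con 1 :+ ((m :+ δ) :+ (k :+ δ))) refl

within-real : ∀ {as : List (Fin n × Fin n)} {p q δ v k} → k < δ → From as p q δ v k →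
  DistLe (λ x y → (x , y) ∈ as) q v k
within-real k<δ f with From⇒DistLe f
... | inj₁ d            = d
... | inj₂ (m , m≤k , _) = contradiction (≤-trans k<δ (≤-trans (m≤n+m _ m) m≤k)) (<-irrefl refl)

module Bridgeless {n : ℕ} (E : Fin n → Fin n → Set) (E? : ∀ u v → Dec (E u v)) (E-sym : ∀ {u v} → E u v → E v u)
                  (E-irrefl : ∀ {u} → ¬ E u u) (diam : DiamLe E 4)
                  (bridgeless : ∀ {u v} → E u v → ∃[ k ] Walk (Avoiding E u v) u v k) where

  open Metric E E? E-sym E-irrefl diam public

  Orientable : Set
  Orientable = ∃[ s ] DiamLe (Arc {X = E} s) 21

  module LongCycles (p q : Fin n) (e-pq : E p q) (no-triangle : ∀ {v} → E v p → ¬ E v q)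
    (no-square : ∀ {u v} → E q u → E u v → E v p → u ≢ p → v ≢ q → ⊥) where

    open Sides p q

    -- Forbidding arcs from the p-side to the q-side keeps every crossing edge available.
    X : Fin n → Fin n → Set
    X u v = E u v × (QSide u ⊎ PSide v ⊎ (u ≡ p × v ≡ q))

    -- With δ = 8 a bound below 8 is attained by a genuine path, from which the path from q to p is read
    -- off; δ = 4, which makes p and q hubs, is good enough afterwards.
    open Ears 0 8 X (λ e g → e , inj₁ g) (λ e l → e , inj₂ (inj₁ l))
    open Rooted p q 4 hiding (I; O)

    PSide-p : PSide p
    PSide-p with dq p in eq
    ... | zero  = contradiction (dist≡0 eq) (E⇒≢ e-pq)
    ... | suc _ = subst (_< _) (sym dist-self) (s≤s z≤n)

    QSide-q : QSide q
    QSide-q = ≤-trans (≤-reflexive dist-self) z≤n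

    start : Partial X
    start = partial (p ∷ q ∷ []) ((p , q) ∷ [])
      (λ { (here refl) → e-pq , inj₂ (inj₂ (refl , refl)) })
      (λ { (here refl) (here eq) → E⇒≢ e-pq (sym (cong proj₁ eq)) })
      (λ { (here refl) → here refl })
      (λ { (here refl) → there (here refl) })

    start-grown : Grown start
    start-grown = grown
      (λ { (here refl) → at-p , at-p (≤-reflexive (sym (trans (ψ-out-p PSide-p) (cong (8 ∸_) dist-self)))) , at-p , at-p ≤-refl
         ; (there (here refl)) → at-q (≤-reflexive (sym (trans (ψ-in-q QSide-q) (cong (8 ∸_) dist-self)))) , at-q , at-q ≤-refl , at-q })
      (here refl) (there (here refl)) (λ _ → z≤n , z≤n)

    -- The exception is the root edge, the one crossing edge that is oriented from the p-side to the
    -- q-side.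
    Crossed : Partial X → Fin n → Fin n → Set
    Crossed s x y = E x y → QSide x → PSide y → Arc s x y ⊎ (x ≡ q × y ≡ p)

    Crossed-⊑ : ∀ {s t x y} → s ⊑ t → Crossed s x y → Crossed t x y
    Crossed-⊑ e c exy ge lt with c exy ge lt
    ... | inj₁ a = inj₁ (arcs⊆ e a)
    ... | inj₂ b = inj₂ b

    cross-edge : ∀ s → Grown s → ∀ x y → ∃[ t ] (s ⊑ t × Grown t × Crossed t x y)
    cross-edge s gr x y with E? x y ×-dec QSide? x ×-dec PSide? y
    ... | no ¬c = s , ⊑-refl , gr , λ e ge lt → contradiction (e , ge , lt) ¬c
    ... | yes (e , ge , lt) with (x , y) ∈ᵃ? arcs s | (x ≟ᶠ q) ×-dec (y ≟ᶠ p) | x ∈? verts s | y ∈? verts s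
    ...   | yes a | _      | _      | _      = s , ⊑-refl , gr , λ _ _ _ → inj₁ a
    ...   | no _  | yes qp | _      | _      = s , ⊑-refl , gr , λ _ _ _ → inj₂ qp
    ...   | no _  | no _   | no x∉  | _      = let t , s⊑t , gr′ , a = cross gr e ge lt (inj₁ x∉) in t , s⊑t , gr′ , λ _ _ _ → inj₁ a
    ...   | no _  | no _   | yes _  | no y∉  = let t , s⊑t , gr′ , a = cross gr e ge lt (inj₂ y∉) in t , s⊑t , gr′ , λ _ _ _ → inj₁ a
    ...   | no _  | no ¬qp | yes x∈ | yes y∈ with insertArc s (e , inj₁ ge) (E⇒≢ e) (λ a → back (proj₂ (allowed s a))) x∈ y∈
      where
      back : ¬ (QSide y ⊎ PSide x ⊎ (y ≡ p × x ≡ q))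
      back (inj₁ gy)                 = <⇒≱ lt gy
      back (inj₂ (inj₁ lx))          = <⇒≱ lx ge
      back (inj₂ (inj₂ (y≡p , x≡q))) = ¬qp (x≡q , y≡p)
    ...     | t , s⊑t , a , vs≡ , _ =
      t , s⊑t , Grown-⊑ s⊑t gr (λ v∈ → Graded-⊑ s⊑t (graded gr (subst (_ ∈_) vs≡ v∈))) , λ _ _ _ → inj₁ a

    cross-all : ∃[ s ] (start ⊑ s × Grown s × (∀ x y → Crossed s x y))
    cross-all =
      let s , e , gr , c = coverAll Grown (λ s x → ∀ y → Crossed s x y) (λ e c y → Crossed-⊑ e (c y))
            (λ s gr x → coverAll Grown (λ s y → Crossed s x y) Crossed-⊑ (λ s gr y → cross-edge s gr x y) s gr)
            start start-grown
      in s , e , gr , c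

    forget : Partial X → Partial E
    forget (partial vs as al an ta he) = partial vs as (proj₁ ∘ al) an ta he

    forget-verts : ∀ s → verts (forget s) ≡ verts s
    forget-verts (partial _ _ _ _ _ _) = refl

    forget-arcs : ∀ s → arcs (forget s) ≡ arcs s
    forget-arcs (partial _ _ _ _ _ _) = refl

    module _ {s : Partial X} (started : start ⊑ s) (gr : Grown s) (crossed : ∀ x y → Crossed s x y) where

      private
        ∈-forget : ∀ {v} → v ∈ verts s → v ∈ verts (forget s)
        ∈-forget = subst (_ ∈_) (sym (forget-verts s))

        i₄ : ∀ {v k} → I s v k → In p q 4 (forget s) v k
        i₄ = To-⊆ (subst (_ ∈_) (sym (forget-arcs s))) (m≤m+n 4 4)

        o₄ : ∀ {v k} → O s v k → Out p q 4 (forget s) v k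
        o₄ = From-⊆ (subst (_ ∈_) (sym (forget-arcs s))) (m≤m+n 4 4)

        i-p : ∀ {v} → v ∈ verts s → PSide v → I s v (dp v)
        i-p {v} v∈ lt = subst (I s v) (trans (ψ-in-p lt) (+-identityʳ _)) (proj₁ (graded gr v∈))

        o-q : ∀ {v} → v ∈ verts s → QSide v → O s v (dq v)
        o-q {v} v∈ ge = subst (O s v) (trans (ψ-out-q ge) (+-identityʳ _)) (proj₁ (proj₂ (graded gr v∈)))

      tame : AllTame (forget s)
      tame v∈f with subst (_ ∈_) (forget-verts s) v∈f
      ... | v∈ with graded gr v∈
      ...   | _ , _ , i , o = i₄ i , o₄ o , side (PSide? _)
        where
        side : Dec (PSide _) → In p q 4 (forget s) _ 6 ⊎ Out p q 4 (forget s) _ 6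
        side (yes lt) = inj₁ (i₄ (To-≤ (≤-trans (dp≤3 lt) (m≤m+n 3 3)) (i-p v∈ lt)))
        side (no ¬lt) = inj₂ (o₄ (From-≤ (≤-trans (dist≤4 q _) (m≤m+n 4 2)) (o-q v∈ (≮⇒≥ ¬lt))))

      hub-q : ∀ {x y} → E x y → QSide x → PSide y → Hub (forget s) x
      hub-q {x} {y} e ge lt with crossed x y e ge lt
      ... | inj₂ (refl , _) = ∈-forget (q∈ gr) , at-q ≤-refl , at-q
      ... | inj₁ a = ∈-forget (tail∈ s a) ,
        i₄ (To-≤ (s≤s (dp≤3 lt)) (step a (i-p (head∈ s a) lt))) , o₄ (From-≤ (dist≤4 q x) (o-q (tail∈ s a) ge))

      -- In contrast to `hub-q`, the distance of x must be restricted: the q-side extends to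
      -- distance 4, and crossing from there would give y the out-bound 5.
      hub-p : ∀ {x y} → E x y → QSide x → PSide y → dq x ≤ 3 → Hub (forget s) y
      hub-p {x} {y} e ge lt dx≤3 with crossed x y e ge lt
      ... | inj₂ (_ , refl) = ∈-forget (p∈ gr) , at-p , at-p ≤-refl
      ... | inj₁ a = ∈-forget (head∈ s a) ,
        i₄ (To-≤ (≤-trans (dp≤3 lt) (n≤1+n 3)) (i-p (head∈ s a) lt)) , o₄ (From-≤ (s≤s dx≤3) (step a (o-q (tail∈ s a) ge)))

      near-p : ∀ {x y} → E x y → QSide x → PSide y → y ∈ verts (forget s) × In p q 4 (forget s) y 5
      near-p {x} {y} e ge lt with crossed x y e ge lt
      ... | inj₂ (_ , refl) = ∈-forget (p∈ gr) , at-p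
      ... | inj₁ a = ∈-forget (head∈ s a) , i₄ (To-≤ (≤-trans (dp≤3 lt) (m≤m+n 3 2)) (i-p (head∈ s a) lt))

      -- A walk from q to p that avoids the edge pq crosses at another edge, whose arc yields a path
      -- of length at most 4 + 1 + 3. The 9 is 2δ + 1 for δ = 4.
      around : DistLe (Arc s) q p 9
      around with crossing PSide? (proj₂ (bridgeless (E-sym e-pq))) (≤⇒≯ QSide-q) PSide-p
      ... | x , y , _ , _ , ¬lx , ly , (e , ≢qp , _) , _ with crossed x y e (≮⇒≥ ¬lx) ly
      ...   | inj₂ qp = contradiction qp ≢qp
      ...   | inj₁ a
        with within-real (s≤s (≤-trans (dist≤4 q x) (m≤m+n 4 3))) (o-q (tail∈ s a) (≮⇒≥ ¬lx)) | To⇒DistLe (i-p (head∈ s a) ly)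
      ...     | qx | inj₁ yp =
        DistLe-≤ (≤-trans (+-mono-≤ (dist≤4 q x) (s≤s (dp≤3 ly))) (n≤1+n 8)) (DistLe-trans qx (let m , m≤ , w = yp in suc m , s≤s m≤ , step a w))
      ...     | qx | inj₂ (m , m≤ , _) =
        contradiction (≤-trans (≤-trans (m≤n+m 8 m) m≤) (dp≤3 ly)) λ { (s≤s (s≤s (s≤s ()))) }

      -- A shortest walk from w to q may leave the p-side only at p, three steps away, which is too
      -- far. The target is therefore a neighbour z of q other than p. Crossing only after three
      -- steps would now mean entering z directly from the p-side, and by `no-return` this
      -- contradicts the distances or closes a triangle or 4-cycle on pq.
      reach-p : ∀ {w} → PSide w → Reachable (forget s) w
      reach-p {w} lt-w with bridgeless (E-sym e-pq)
      ... | _ , here = contradiction e-pq E-irrefl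
      ... | _ , step {w = z} (e-qz , ≢qp , _) _ with diam w z
      ...   | m , m≤4 , wz with crossing QSide? wz (<⇒≱ lt-w) ge-z
        where
        dq-z : dq z ≤ 1
        dq-z = dist-walk (step (E-sym e-qz) here)
        z≢p : z ≢ p
        z≢p z≡p = ≢qp (refl , z≡p)
        ge-z : QSide z
        ge-z with dp z in eq
        ... | zero  = contradiction (dist≡0 eq) z≢p
        ... | suc _ = ≤-trans dq-z (s≤s z≤n)
      ...     | y , x , i , j , ¬gy , gx , e-yx , wy , xz , refl = conclude i wy (≤-trans (≤-reflexive (sym (+-suc i j))) m≤4)
        where
        ly : PSide y
        ly = ≰⇒> ¬gy
        dq-x : dq x ≤ suc j
        dq-x = ≤-trans (dist-walk (proj₂ (proj₂ (snoc (j , ≤-refl , xz) (E-sym e-qz))))) (proj₁ (proj₂ (snoc (j , ≤-refl , xz) (E-sym e-qz))))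
        no-return : E y z → ⊥
        no-return e-yz = level (dp y) refl
          where
          level : ∀ k → dp y ≡ k → ⊥
          level 0 dy≡ = no-triangle (subst (E z) (dist≡0 dy≡) (E-sym e-yz)) (E-sym e-qz)
          level 1 dy≡ = no-square e-qz (E-sym e-yz) (dist≡1 dy≡) (λ z≡p → ≢qp (refl , z≡p)) λ { refl → ¬gy QSide-q }
          level (suc (suc k)) dy≡ = <⇒≱ ly
            (≤-trans (dist-walk (step e-yz (step (E-sym e-qz) here))) (≤-trans (s≤s (s≤s z≤n)) (≤-reflexive (sym dy≡))))
        length-0 : ∀ {j} → Walk E x z j → j ≤ 0 → x ≡ z
        length-0 here _ = refl
        conclude : ∀ i → Walk E w y i → suc (i + j) ≤ 4 → Reachable (forget s) w
        conclude 0 here _ = inj₁ (proj₁ (near-p (E-sym e-yx) gx ly))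
        conclude 1 (step e here) _ = let y∈ , i = near-p (E-sym e-yx) gx ly in inj₂ (inj₁ (y , e , y∈ , inj₁ i))
        conclude 2 (step e (step e′ here)) (s≤s (s≤s (s≤s j≤1))) =
          inj₂ (inj₂ (_ , y , e , e′ , hub-p (E-sym e-yx) gx ly (≤-trans dq-x (≤-trans (s≤s j≤1) (n≤1+n 2)))))
        conclude 3 _ (s≤s (s≤s (s≤s (s≤s j≤0)))) = ⊥-elim (no-return (subst (E y) (length-0 xz j≤0) e-yx))
        conclude (suc (suc (suc (suc i)))) _ (s≤s (s≤s (s≤s (s≤s ()))))

      reach-q : ∀ {w} → QSide w → Within PSide 3 w → Reachable (forget s) w
      reach-q {w} ge-w near with Within⇒Walk 3 near
      ... | z , m , wz , m≤3 , lz with crossing PSide? wz (≤⇒≯ ge-w) lz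
      ...   | x , y , i , j , ¬lx , ly , e-xy , wx , _ , refl = conclude i wx (≤-trans (≤-reflexive (sym (+-suc i j))) m≤3)
        where
        hub : Hub (forget s) x
        hub = hub-q e-xy (≮⇒≥ ¬lx) ly
        conclude : ∀ i → Walk E w x i → suc (i + j) ≤ 3 → Reachable (forget s) w
        conclude 0 here _ = inj₁ (proj₁ hub)
        conclude 1 (step e here) _ = inj₂ (inj₁ (x , e , proj₁ hub , inj₁ (To-≤ (n≤1+n 4) (proj₁ (proj₂ hub)))))
        conclude 2 (step e (step e′ here)) _ = inj₂ (inj₂ (_ , x , e , e′ , hub))
        conclude (suc (suc (suc i))) _ (s≤s (s≤s (s≤s ())))

      conclude : (∀ w → ¬ Within PSide 3 w → Near (forget s) w) → Orientable
      conclude rescue with complete bridgeless (forget s) tame reach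
        where
        reach : ∀ w → Reachable (forget s) w
        reach w with PSide? w | within? PSide? 3 w
        ... | yes lt | _        = reach-p lt
        ... | no ¬lt | yes near = reach-q (≮⇒≥ ¬lt) near
        ... | no ¬lt | no ¬near = inj₂ (inj₁ (rescue w ¬near))
      ... | t , e , near = t , rooted⇒DiamLe 4 (DistLe-⊆ (1 , ≤-refl , step pq here)) (DistLe-⊆ around) near
        where
        s⊆t : arcs s ⊆ arcs t
        s⊆t = arcs⊆ e ∘ subst (_ ∈_) (sym (forget-arcs s))
        DistLe-⊆ : ∀ {u v k} → DistLe (Arc s) u v k → DistLe (Arc t) u v k
        DistLe-⊆ (m , m≤k , w) = m , m≤k , Walk-map s⊆t w
        pq : Arc s p q
        pq = arcs⊆ started (here refl)

    -- Vertices at distance at least 4 from the p-side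

    QStrict : Fin n → Set
    QStrict v = dq v < dp v

    dp≤1+dq : ∀ v → dp v ≤ suc (dq v)
    dp≤1+dq v with Within⇒Walk (dq v) (dist⇒Within {T = _≡ q} {k = dq v} ≤-refl refl)
    ... | _ , m , w , m≤ , refl with snoc (m , ≤-refl , w) (E-sym e-pq)
    ...   | j , j≤ , w′ = ≤-trans (dist-walk w′) (≤-trans j≤ (s≤s m≤))

    -- An ear from the direction of q through r and b, landing at b or at c, gives r the
    -- out-distance 2 and so makes w `Near`.
    record Detour (w : Fin n) : Set where
      constructor detour
      field
        {r b c y} : Fin n
        e-wr  : E w r
        e-rb  : E r b
        e-bc  : E b c
        e-cy  : E c y
        dq-r  : dq r ≡ 2
        dq-b  : dq b ≡ 3
        dq-c  : dq c ≡ 2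
        dp-y  : dp y ≡ 1
        ge-r  : QSide r
        ge-b  : QSide b
        ge-c  : QSide c
        lt-y  : PSide y

    -- A shortest path from w to p has length 4 and its last vertex before p is q, since a neighbour
    -- of p on the p-side would be within 3 of w. So its first vertex r has distances 3 and 2 to p
    -- and q. The next vertex b on a walk of length at most 4 from r to w₀ is too near w₀ to be
    -- strictly nearer to q and too near w to be on the p-side. Hence b is equidistant from p and q,
    -- and only distance 3 is possible; c and y continue towards p.
    detours : ∀ {w₀} → ¬ Within QStrict 3 w₀ → ∀ {w} → ¬ Within PSide 3 w → Detour w
    detours {w₀} far₀ {w} far = from-w (dp w) refl
      where
      ¬p₂ : ∀ {u v} → E w u → E u v → ¬ PSide v
      ¬p₂ e e′ lt = far (inj₂ (_ , e , inj₂ (_ , e′ , inj₁ lt)))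
      ¬p₃ : ∀ {u v x} → E w u → E u v → E v x → ¬ PSide x
      ¬p₃ e e′ e″ lt = far (inj₂ (_ , e , inj₂ (_ , e′ , inj₂ (_ , e″ , lt))))

      across : ∀ {r b} → E w r → dp r ≡ 3 → dq r ≡ 2 → E r b → dp b ≤ dq b → dq b ≤ dp b → Detour w
      across {r} {b} e-wr dpr dqr e-rb p≤q q≤p = by (dp b) refl
        where
        dq≤3 : dq b ≤ 3
        dq≤3 = ≤-trans (dist-edge (E-sym e-rb)) (s≤s (≤-reflexive dqr))
        2≤dp : 2 ≤ dp b
        2≤dp = s≤s⁻¹ (≤-trans (≤-reflexive (sym dpr)) (dist-edge e-rb))
        by : ∀ k → dp b ≡ k → Detour w
        by 0 dpb = contradiction (≤-trans 2≤dp (≤-reflexive dpb)) λ ()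
        by 1 dpb = contradiction (≤-trans 2≤dp (≤-reflexive dpb)) λ { (s≤s ()) }
        by 2 dpb with closer dpb
        ... | v , e-bv , dpv with next-to-p no-triangle dpv
        ...   | inj₂ lt   = contradiction lt (¬p₃ e-wr e-rb e-bv)
        ...   | inj₁ refl = contradiction (≤-trans (≤-trans 2≤dp p≤q) (dist-walk (step e-bv here))) λ { (s≤s ()) }
        by 3 dpb with closer dpb
        ... | c , e-bc , dpc with closer dpc
        ...   | y , e-cy , dpy = finish (next-to-p no-triangle dpy)
          where
          dqb : dq b ≡ 3
          dqb = ≤-antisym dq≤3 (≤-trans (≤-reflexive (sym dpb)) p≤q)
          ge-c : QSide c
          ge-c = ≮⇒≥ (¬p₃ e-wr e-rb e-bc)
          dqc : dq c ≡ 2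
          dqc = ≤-antisym (≤-trans ge-c (≤-reflexive dpc)) (s≤s⁻¹ (≤-trans (≤-reflexive (sym dqb)) (dist-edge e-bc)))
          finish : y ≡ q ⊎ PSide y → Detour w
          finish (inj₁ refl) = contradiction (≤-trans (≤-reflexive (sym dqc)) (dist-walk (step e-cy here))) λ { (s≤s ()) }
          finish (inj₂ lt-y) = detour e-wr e-rb e-bc e-cy dqr dqb dqc dpy
            (≤-trans (≤-reflexive dqr) (≤-trans (s≤s (s≤s z≤n)) (≤-reflexive (sym dpr)))) q≤p ge-c lt-y
        by (suc (suc (suc (suc k)))) dpb = contradiction (≤-trans (≤-reflexive (sym dpb)) (≤-trans p≤q dq≤3)) λ { (s≤s (s≤s (s≤s ()))) }

      from-r : ∀ {r} → E w r → dp r ≡ 3 → dq r ≡ 2 → Detour w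
      from-r {r} e-wr dpr dqr with diam r w₀
      ... | _ , _ , here = contradiction (inj₁ (≤-reflexive (trans (cong suc dqr) (sym dpr)))) far₀
      ... | _ , s≤s m≤3 , step {w = b} e-rb w₁ =
        across e-wr dpr dqr e-rb
          (≮⇒≥ λ qs → far₀ (Walk⇒Within (Walk-reverse E-sym w₁ here) (≤-trans (≤-reflexive (+-identityʳ _)) m≤3) qs))
          (≮⇒≥ (¬p₂ e-wr e-rb))

      close : dp w ≤ 3 → Within PSide 3 w
      close dp≤3 = dist⇒Within {T = PSide} dp≤3 PSide-p

      from-w : ∀ k → dp w ≡ k → Detour w
      from-w (suc (suc (suc (suc zero)))) dpw with closer dpw
      ... | r , e-wr , dpr with closer dpr
      ...   | v , e-rv , dpv with closer dpv
      ...     | x , e-vx , dpx with next-to-p no-triangle dpx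
      ...       | inj₂ lt   = contradiction lt (¬p₃ e-wr e-rv e-vx)
      ...       | inj₁ refl = from-r e-wr dpr
        (≤-antisym (dist-walk (step e-rv (step e-vx here))) (s≤s⁻¹ (≤-trans (≤-reflexive (sym dpr)) (dp≤1+dq r))))
      from-w (suc (suc (suc (suc (suc k))))) dpw = contradiction (≤-trans (≤-reflexive (sym dpw)) (dist≤4 p w)) λ { (s≤s (s≤s (s≤s (s≤s ())))) }
      from-w 0 dpw = contradiction (close (≤-trans (≤-reflexive dpw) z≤n)) far
      from-w 1 dpw = contradiction (close (≤-trans (≤-reflexive dpw) (s≤s z≤n))) far
      from-w 2 dpw = contradiction (close (≤-trans (≤-reflexive dpw) (s≤s (s≤s z≤n)))) far
      from-w 3 dpw = contradiction (close (≤-reflexive dpw)) far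

    Rescued : Partial X → Fin n → Set
    Rescued s w = ¬ Within PSide 3 w → ∃[ r ] (E w r × r ∈ verts s × QSide r × dq r ≡ 2)

    Rescued-⊑ : ∀ {s t w} → s ⊑ t → Rescued s w → Rescued t w
    Rescued-⊑ e res far = let r , e-wr , r∈ , ge , d≡ = res far in r , e-wr , verts⊆ e r∈ , ge , d≡

    take-detour : ∀ {s} → Grown s → (∀ x y → Crossed s x y) → ∀ {w} → Detour w → ∃[ t ] (s ⊑ t × Grown t × Rescued t w)
    take-detour {s} gr crossed (detour {r} {b} {c} {y} e-wr e-rb e-bc e-cy dqr dqb dqc dpy ge-r ge-b ge-c lt-y)
      with r ∈? verts s | b ∈? verts s | ↘-q ge-r ge-b (trans dqb (cong suc (sym dqr)))
    ... | yes r∈ | _ | _ = s , ⊑-refl , gr , λ _ → r , e-wr , r∈ , ge-r , dqr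
    ... | no r∉ | yes b∈ | r↘b
      with climb gr 2 dqr ge-r r∉ (land (e-rb , inj₁ ge-r) b∈ (proj₁ (graded gr b∈)) (_↘_.in< r↘b)) (<⇒≤ (_↘_.out< r↘b))
    ...   | t , e , gr′ , end a = t , e , gr′ , λ _ → r , e-wr , tail∈ t a , ge-r , dqr
    take-detour {s} gr crossed (detour {r} {b} {c} {y} e-wr e-rb e-bc e-cy dqr dqb dqc dpy ge-r ge-b ge-c lt-y)
        | no r∉ | no b∉ | r↘b with crossed c y e-cy ge-c lt-y
    ... | inj₂ (refl , _) = contradiction (trans (sym dist-self) dqc) λ ()
    -- The potential `ψ-in c` is 6 and exceeds `ψ-in b`, which is 5, but the crossing arc to y gives
    -- c the in-distance 2. The ear starts nearer to q than r, and c is as far from q as r, so the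
    -- ends differ.
    ... | inj₁ a
      with climb gr 2 dqr ge-r r∉
             (fall (e-rb , inj₁ ge-r) r↘b b∉ (land (e-bc , inj₁ ge-b) (tail∈ s a) (step a (proj₁ (graded gr (head∈ s a)))) c<b))
             (≤-reflexive (trans (ψ-out-q ge-r) (trans (cong (_+ 0) (trans dqr (sym dqc))) (sym (ψ-out-q ge-c)))))
      where
      c<b : suc (ψ-in y) < ψ-in b
      c<b = ≤-trans (≤-reflexive (cong (λ k → suc (suc k)) (trans (ψ-in-p lt-y) (cong (_+ 0) dpy))))
                    (≤-trans (m≤m+n 3 2) (≤-reflexive (sym (trans (ψ-in-q ge-b) (cong (8 ∸_) dqb)))))
    ...   | t , e , gr′ , a′ ◂ _ = t , e , gr′ , λ _ → r , e-wr , tail∈ t a′ , ge-r , dqr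

    orientable : (∀ w → Within PSide 3 w) ⊎ ∃[ w ] (¬ Within QStrict 3 w) → Orientable
    orientable (inj₁ all-near) with cross-all
    ... | s , started , gr , crossed = conclude started gr crossed λ w far → contradiction (all-near w) far
    orientable (inj₂ (w₀ , far₀)) with cross-all
    ... | s , started , gr , crossed
      with coverAll (λ t → s ⊑ t × Grown t) Rescued Rescued-⊑ next s (⊑-refl , gr)
      where
      next : ∀ t → s ⊑ t × Grown t → ∀ w → ∃[ u ] (t ⊑ u × (s ⊑ u × Grown u) × Rescued u w)
      next t (s⊑t , gr′) w with within? PSide? 3 w
      ... | yes near = t , ⊑-refl , (s⊑t , gr′) , λ far → contradiction near far
      ... | no far with take-detour gr′ (λ x y → Crossed-⊑ s⊑t (crossed x y)) (detours far₀ far)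
      ...   | u , t⊑u , gr″ , res = u , t⊑u , (⊑-trans s⊑t t⊑u , gr″) , res
    ... | t , s⊑t , (_ , gr′) , rescued =
      conclude (⊑-trans started s⊑t) gr′ (λ x y → Crossed-⊑ s⊑t (crossed x y)) near
      where
      near : ∀ w → ¬ Within PSide 3 w → Near (forget t) w
      near w far with rescued w far
      ... | r , e-wr , r∈ , ge , d≡ =
        r , e-wr , subst (r ∈_) (sym (forget-verts t)) r∈ ,
        inj₂ (From-⊆ (subst (_ ∈_) (sym (forget-arcs t))) (m≤m+n 4 4)
          (From-≤ (≤-trans (≤-reflexive (trans (ψ-out-q ge) (cong (_+ 0) d≡))) (m≤m+n 2 3)) (proj₁ (proj₂ (graded gr′ r∈)))))

  -- The vertices strictly nearer to q form the p-side of the exchanged pair (q , p). Either some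
  -- vertex is far from them, which supplies w₀ for the detours of (p , q), or none is, and the
  -- exchanged pair needs no detours.
  no-short-cycle⇒orientable : ∀ {p q} → E p q → (∀ {v} → E v p → ¬ E v q) →
    (∀ {u v} → E q u → E u v → E v p → u ≢ p → v ≢ q → ⊥) → Orientable
  no-short-cycle⇒orientable {p} {q} e-pq no-triangle no-square
    with any? (λ w → ¬? (within? (λ v → dist q v <? dist p v) 3 w))
  ... | yes far = LongCycles.orientable p q e-pq no-triangle no-square (inj₂ far)
  ... | no ¬far = LongCycles.orientable q p (E-sym e-pq) (λ e e′ → no-triangle e′ e)
    (λ e-pu e-uv e-vq u≢q v≢p → no-square (E-sym e-vq) (E-sym e-uv) (E-sym e-pu) v≢p u≢q)
    (inj₁ λ w → decidable-stable (within? (λ v → dist q v <? dist p v) 3 w) λ ¬near → ¬far (w , ¬near))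

  -- Graphs all of whose edges lie in short cycles

  -- Both roots are r and δ = 0. The third vertex x of a triangle on uv is adjacent to the base u as
  -- well, which is what `attach` asks of x when x is still uncovered.
  triangles⇒orientable : (∀ {u v} → E u v → ∃[ x ] (E u x × E x v)) → Fin n → Orientable
  triangles⇒orientable triangle r = conclude (layers 4)
    where
    open Rooted r r 0
    Layer : ℕ → Set
    Layer k = ∃[ s ] ((∀ {v} → v ∈ verts s → I s v (k * 2) × O s v (k * 2)) × (∀ v → dist r v ≤ k → v ∈ verts s))
    layers : ∀ k → Layer k
    layers zero =
      partial (r ∷ []) [] (λ ()) (λ ()) (λ ()) (λ ()) , (λ { (here refl) → at-p , at-q }) ,
      λ v d≤0 → here (dist≡0 (n≤0⇒n≡0 d≤0))
    layers (suc k) with layers k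
    ... | s , inv , all∈ with coverAll (λ t → s ⊑ t × (∀ {v} → v ∈ verts t → Layered (k * 2) t v))
            (λ t v → dist r v ≤ suc k → v ∈ verts t) (λ e d d≤ → verts⊆ e (d d≤)) next s
            (⊑-refl , λ v∈ → let i , o = inv v∈ in To-≤ (m≤n+m _ 2) i , From-≤ (m≤n+m _ 2) o , inj₁ (To-≤ (n≤1+n _) i))
      where
      next : ∀ t → s ⊑ t × (∀ {v} → v ∈ verts t → Layered (k * 2) t v) → ∀ v →
        ∃[ u ] (t ⊑ u × (s ⊑ u × (∀ {v} → v ∈ verts u → Layered (k * 2) u v)) × (dist r v ≤ suc k → v ∈ verts u))
      next t (s⊑t , inv-t) v with v ∈? verts t | dist r v ≟ suc k
      ... | yes v∈ | _ = t , ⊑-refl , (s⊑t , inv-t) , λ _ → v∈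
      ... | no  v∉ | no d≢ = t , ⊑-refl , (s⊑t , inv-t) , λ d≤ → verts⊆ s⊑t (all∈ v (s≤s⁻¹ (≤∧≢⇒< d≤ d≢)))
      ... | no  v∉ | yes d≡ with closer d≡
      ...   | u , e-vu , du≡ with triangle e-vu | all∈ u (≤-reflexive du≡)
      ...     | x , e-vx , e-xu | u∈ with attach t inv-t v∉ e-vu base e-vx (E⇒≢ e-xu) (inj₂ (u , e-xu , base))
        where
        base : Base (k * 2) t u
        base = let i , o = inv u∈ in Base-⊑ s⊑t (u∈ , i , o)
      ...       | t′ , t⊑t′ , inv′ , v∈ = t′ , t⊑t′ , (⊑-trans s⊑t t⊑t′ , inv′) , λ _ → v∈
    ... | t , _ , (_ , inv-t) , all∈-t = t , (λ v∈ → let i , o , _ = inv-t v∈ in i , o) , all∈-t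
    conclude : Layer 4 → Orientable
    conclude (s , inv , all∈) = s , rooted⇒DiamLe 0 (0 , z≤n , here) (0 , z≤n , here)
      (λ v → let i , o = inv (all∈ v (dist≤4 r v)) in To-≤ (m≤m+n 8 2) i , From-≤ (m≤m+n 8 2) o)

  -- Every edge in a triangle or 4-cycle, the edge pq in no triangle

  module ShortCycles (p q : Fin n) (e-pq : E p q) (no-triangle : ∀ {v} → E v p → ¬ E v q)
    (short : ∀ {u v} → E u v → (∃[ x ] (E u x × E x v)) ⊎
      (∃[ x ] ∃[ y ] (E u x × E x y × E y v × x ≢ v × u ≢ y))) where

    open Sides p q
    open Rooted p q 1
    open Ears 2 1 E (λ e _ → e) (λ e _ → e) hiding (I; O)

    -- The pairs of distances occurring along a 4-cycle through p or through q.
    Typed : Partial E → Fin n → Set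
    Typed s v = (I s v 3 × O s v 2) ⊎ (I s v 2 × O s v 3) ⊎ (E v p × I s v 1 × O s v 4) ⊎ (E v q × I s v 4 × O s v 1)

    Typed-⊑ : ∀ {s t v} → s ⊑ t → Typed s v → Typed t v
    Typed-⊑ e (inj₁ (i , o))                      = inj₁ (I-⊑ e i , O-⊑ e o)
    Typed-⊑ e (inj₂ (inj₁ (i , o)))               = inj₂ (inj₁ (I-⊑ e i , O-⊑ e o))
    Typed-⊑ e (inj₂ (inj₂ (inj₁ (a , i , o))))    = inj₂ (inj₂ (inj₁ (a , I-⊑ e i , O-⊑ e o)))
    Typed-⊑ e (inj₂ (inj₂ (inj₂ (a , i , o))))    = inj₂ (inj₂ (inj₂ (a , I-⊑ e i , O-⊑ e o)))

    typed⇒4 : ∀ {s v} → Typed s v → I s v 4 × O s v 4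
    typed⇒4 (inj₁ (i , o))                   = To-≤ (n≤1+n 3) i , From-≤ (m≤m+n 2 2) o
    typed⇒4 (inj₂ (inj₁ (i , o)))            = To-≤ (m≤m+n 2 2) i , From-≤ (n≤1+n 3) o
    typed⇒4 (inj₂ (inj₂ (inj₁ (_ , i , o)))) = To-≤ (m≤m+n 1 3) i , o
    typed⇒4 (inj₂ (inj₂ (inj₂ (_ , i , o)))) = i , From-≤ (m≤m+n 1 3) o

    -- With δ = 1 the in- and out-distances are (0 , 1) at p and (1 , 0) at q. A 4-cycle through p
    -- therefore gives (3 , 2), (2 , 3), (1 , 4), and one through q gives (4 , 1), (3 , 2), (2 , 3);
    -- the overlap lets four types serve both roots. By `close`, every typed vertex can be the other
    -- end of a one-vertex ear at r.
    record Root (r : Fin n) (a b : ℕ) : Set where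
      field
        root-in  : ∀ s → I s r a
        root-out : ∀ s → O s r b
        first    : ∀ s {v} → E v r → I s v (3 + a) → O s v (1 + b) → Typed s v
        middle   : ∀ s {v} → I s v (2 + a) → O s v (2 + b) → Typed s v
        last     : ∀ s {v} → E v r → I s v (1 + a) → O s v (3 + b) → Typed s v
        close    : ∀ s {v} → Typed s v → I s v (2 + a) ⊎ O s v (2 + b)

    root-p : Root p 0 1
    root-p = record
      { root-in  = λ _ → at-p
      ; root-out = λ _ → at-p ≤-refl
      ; first    = λ _ _ i o → inj₁ (i , o)
      ; middle   = λ _ i o → inj₂ (inj₁ (i , o))
      ; last     = λ _ e i o → inj₂ (inj₂ (inj₁ (e , i , o)))
      ; close    = λ { _ (inj₁ (_ , o)) → inj₂ (From-≤ (n≤1+n 2) o)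
                     ; _ (inj₂ (inj₁ (i , _))) → inj₁ i
                     ; _ (inj₂ (inj₂ (inj₁ (_ , i , _)))) → inj₁ (To-≤ (n≤1+n 1) i)
                     ; _ (inj₂ (inj₂ (inj₂ (_ , _ , o)))) → inj₂ (From-≤ (m≤m+n 1 2) o) }
      }

    root-q : Root q 1 0
    root-q = record
      { root-in  = λ _ → at-q ≤-refl
      ; root-out = λ _ → at-q
      ; first    = λ _ e i o → inj₂ (inj₂ (inj₂ (e , i , o)))
      ; middle   = λ _ i o → inj₁ (i , o)
      ; last     = λ _ _ i o → inj₂ (inj₁ (i , o))
      ; close    = λ { _ (inj₁ (i , _)) → inj₁ i
                     ; _ (inj₂ (inj₁ (i , _))) → inj₁ (To-≤ (n≤1+n 2) i)
                     ; _ (inj₂ (inj₂ (inj₁ (_ , i , _)))) → inj₁ (To-≤ (m≤m+n 1 2) i)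
                     ; _ (inj₂ (inj₂ (inj₂ (_ , _ , o)))) → inj₂ (From-≤ (n≤1+n 1) o) }
      }

    AllTyped : Partial E → Set
    AllTyped s = ∀ {v} → v ∈ verts s → Typed s v

    module _ {r a b} (root : Root r a b) where
      open Root root

      cover-neighbour : (s : Partial E) → AllTyped s → r ∈ verts s → ∀ {d} → d ∉ verts s → E d r →
        ∃[ t ] (s ⊑ t × AllTyped t × d ∈ verts t)
      cover-neighbour s typed r∈ {d} d∉ e-dr = by (short e-dr)
        where
        via : ∀ {x} → E d x → x ≢ r → x ∈ verts s → ∃[ t ] (s ⊑ t × AllTyped t × d ∈ verts t)
        via {x} e-dx x≢r x∈ with close s (typed x∈)
        ... | inj₁ i = pick (here refl) (ear Typed Typed-⊑ s typed (E-sym e-dr ◂ end e-dx) r∈ x∈ (d∉ ∷ []) ([] ∷ [])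
                (inj₁ (x≢r ∘ sym)) λ { t e (f ◂ end g) → first t e-dr (step g (I-⊑ e i)) (step f (root-out t)) ∷ [] })
        ... | inj₂ o = pick (here refl) (ear Typed Typed-⊑ s typed (E-sym e-dx ◂ end e-dr) x∈ r∈ (d∉ ∷ []) ([] ∷ [])
                (inj₁ x≢r) λ { t e (f ◂ end g) → last t e-dr (step g (root-in t)) (step f (O-⊑ e o)) ∷ [] })
        by : (∃[ x ] (E d x × E x r)) ⊎ (∃[ x ] ∃[ y ] (E d x × E x y × E y r × x ≢ r × d ≢ y)) →
          ∃[ t ] (s ⊑ t × AllTyped t × d ∈ verts t)
        by (inj₁ (x , e-dx , e-xr)) with x ∈? verts s
        ... | yes x∈ = via e-dx (E⇒≢ e-xr) x∈
        ... | no  x∉ = pick (here refl) (ear Typed Typed-⊑ s typed (E-sym e-dr ◂ e-dx ◂ end e-xr) r∈ r∈ (d∉ ∷ x∉ ∷ [])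
                ((E⇒≢ e-dx ∷ []) ∷ [] ∷ []) (inj₂ λ ()) λ { t e (f ◂ g ◂ end h) →
                  let i-x = step h (root-in t)
                      o-d = step f (root-out t)
                  in middle t (step g i-x) (From-≤ (n≤1+n _) o-d) ∷ middle t (To-≤ (n≤1+n _) i-x) (step g o-d) ∷ [] })
        by (inj₂ (x , y , e-dx , e-xy , e-yr , x≢r , d≢y)) with x ∈? verts s | y ∈? verts s
        ... | yes x∈ | _ = via e-dx x≢r x∈
        ... | no x∉ | no y∉ =
          pick (here refl) (ear Typed Typed-⊑ s typed (E-sym e-dr ◂ e-dx ◂ e-xy ◂ end e-yr) r∈ r∈ (d∉ ∷ x∉ ∷ y∉ ∷ [])
            ((E⇒≢ e-dx ∷ d≢y ∷ []) ∷ (E⇒≢ e-xy ∷ []) ∷ [] ∷ []) (inj₂ λ ()) λ { t e (f ◂ g ◂ h ◂ end k) →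
              let i-y = step k (root-in t)
                  i-x = step h i-y
                  o-d = step f (root-out t)
                  o-x = step g o-d
              in first t e-dr (step g i-x) o-d ∷ middle t i-x o-x ∷ last t e-yr i-y (step h o-x) ∷ [] })
        -- Once its edge to r is oriented, y is the last or the first vertex of a 4-cycle through r,
        -- and x and d take the two remaining places.
        ... | no x∉ | yes y∈ with orientEdge s e-yr y∈ r∈
        ...   | t₁ , s⊑t₁ , vs≡ , a = toward a
          where
          typed₁ : AllTyped t₁
          typed₁ v∈ = Typed-⊑ s⊑t₁ (typed (subst (_ ∈_) vs≡ v∈))
          ∉₁ : ∀ {v} → v ∉ verts s → v ∉ verts t₁
          ∉₁ v∉ v∈ = v∉ (subst (_ ∈_) vs≡ v∈)
          extend : ∃[ t ] (t₁ ⊑ t × AllTyped t × d ∈ verts t) → ∃[ t ] (s ⊑ t × AllTyped t × d ∈ verts t)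
          extend (t , e , typed-t , d∈) = t , ⊑-trans s⊑t₁ e , typed-t , d∈
          toward : Arc t₁ y r ⊎ Arc t₁ r y → ∃[ t ] (s ⊑ t × AllTyped t × d ∈ verts t)
          toward (inj₁ yr) = extend (pick (here refl) (ear Typed Typed-⊑ t₁ typed₁ (E-sym e-dr ◂ e-dx ◂ end e-xy)
            (verts⊆ s⊑t₁ r∈) (verts⊆ s⊑t₁ y∈) (∉₁ d∉ ∷ ∉₁ x∉ ∷ []) ((E⇒≢ e-dx ∷ []) ∷ [] ∷ []) (inj₂ λ ())
            λ { t e (f ◂ g ◂ end h) →
              let i-x = step h (step (arcs⊆ e yr) (root-in t))
                  o-d = step f (root-out t)
              in first t e-dr (step g i-x) o-d ∷ middle t i-x (step g o-d) ∷ [] }))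
          toward (inj₂ ry) = extend (pick (there (here refl)) (ear Typed Typed-⊑ t₁ typed₁ (E-sym e-xy ◂ E-sym e-dx ◂ end e-dr)
            (verts⊆ s⊑t₁ y∈) (verts⊆ s⊑t₁ r∈) (∉₁ x∉ ∷ ∉₁ d∉ ∷ []) ((E⇒≢ (E-sym e-dx) ∷ []) ∷ [] ∷ []) (inj₂ λ ())
            λ { t e (f ◂ g ◂ end h) →
              let i-d = step h (root-in t)
                  o-x = step f (step (arcs⊆ e ry) (root-out t))
              in middle t (step g i-d) o-x ∷ last t e-dr i-d (step g o-x) ∷ [] }))

      cover-neighbours : (s : Partial E) → AllTyped s → r ∈ verts s →
        ∃[ t ] (s ⊑ t × AllTyped t × (∀ v → E v r → v ∈ verts t))
      cover-neighbours s typed r∈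
        with coverAll (λ t → s ⊑ t × AllTyped t) (λ t v → E v r → v ∈ verts t) (λ e d a → verts⊆ e (d a)) next s (⊑-refl , typed)
        where
        next : ∀ t → s ⊑ t × AllTyped t → ∀ v → ∃[ u ] (t ⊑ u × (s ⊑ u × AllTyped u) × (E v r → v ∈ verts u))
        next t (s⊑t , typed-t) v with E? v r | v ∈? verts t
        ... | no ¬e | _      = t , ⊑-refl , (s⊑t , typed-t) , λ e → contradiction e ¬e
        ... | yes _ | yes v∈ = t , ⊑-refl , (s⊑t , typed-t) , λ _ → v∈
        ... | yes e | no v∉ with cover-neighbour t typed-t (verts⊆ s⊑t r∈) v∉ e
        ...   | u , t⊑u , typed-u , v∈ = u , t⊑u , (⊑-trans s⊑t t⊑u , typed-u) , λ _ → v∈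
      ... | t , s⊑t , (_ , typed-t) , all∈ = t , s⊑t , typed-t , all∈

    rim : ∃[ s ] (AllTyped s × p ∈ verts s × q ∈ verts s × Arc s p q × DistLe (Arc s) q p 3)
    rim with short e-pq
    ... | inj₁ (x , e-px , e-xq) = contradiction e-xq (no-triangle (E-sym e-px))
    ... | inj₂ (x , y , e-px , e-xy , e-yq , x≢q , p≢y)
      with insertEar start {q} {p} (E-sym e-yq ◂ E-sym e-xy ◂ end (E-sym e-px)) (there (here refl)) (here refl)
             ((λ { (here y≡p) → p≢y (sym y≡p) ; (there (here y≡q)) → E⇒≢ e-yq y≡q })
              ∷ (λ { (here x≡p) → E⇒≢ e-px (sym x≡p) ; (there (here x≡q)) → x≢q x≡q }) ∷ [])
             ((E⇒≢ (E-sym e-xy) ∷ []) ∷ [] ∷ []) (inj₂ λ ())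
      where
      start : Partial E
      start = partial (p ∷ q ∷ []) ((p , q) ∷ [])
        (λ { (here refl) → e-pq })
        (λ { (here refl) (here eq) → E⇒≢ e-pq (sym (cong proj₁ eq)) })
        (λ { (here refl) → here refl })
        (λ { (here refl) → there (here refl) })
    ...   | s , e , a ◂ b ◂ end c , vs≡ =
      s , (λ v∈ → typed (subst (_ ∈_) vs≡ v∈)) , verts⊆ e (here refl) , verts⊆ e (there (here refl)) , arcs⊆ e (here refl)
        , 3 , ≤-refl , step a (step b (step c here))
      where
      typed : ∀ {v} → v ∈ y ∷ x ∷ p ∷ q ∷ [] → Typed s v
      typed (here refl)                         = inj₁ (To-≤ (n≤1+n 2) (step b (step c at-p)) , From-≤ (n≤1+n 1) (step a at-q))
      typed (there (here refl))                 = inj₁ (To-≤ (m≤m+n 1 2) (step c at-p) , step b (step a at-q))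
      typed (there (there (here refl)))         = inj₁ (at-p , at-p (n≤1+n 1))
      typed (there (there (there (here refl)))) = inj₁ (at-q (m≤m+n 1 2) , at-q)

    core : ∃[ s ] (AllTyped s × p ∈ verts s × q ∈ verts s × Arc s p q × DistLe (Arc s) q p 3 ×
                   (∀ v → E v p → v ∈ verts s) × (∀ v → E v q → v ∈ verts s))
    core with rim
    ... | s , typed , p∈ , q∈ , pq , m , m≤3 , w with cover-neighbours root-p s typed p∈
    ...   | s₁ , s⊑s₁ , typed₁ , near-p with cover-neighbours root-q s₁ typed₁ (verts⊆ s⊑s₁ q∈)
    ...     | s₂ , s₁⊑s₂ , typed₂ , near-q =
      s₂ , typed₂ , verts⊆ e p∈ , verts⊆ e q∈ , arcs⊆ e pq , (m , m≤3 , Walk-map (arcs⊆ e) w)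
         , (λ v a → verts⊆ s₁⊑s₂ (near-p v a)) , near-q
      where
      e : s ⊑ s₂
      e = ⊑-trans s⊑s₁ s₁⊑s₂

    -- The slack 2 is what a neighbour of p with in-distance 3, or of q with out-distance 3,
    -- requires. The in-distance 4 of a neighbour of q would be too much on the p-side, but there
    -- such a neighbour is p itself. A neighbour of p on the q-side is q, or it would form a
    -- triangle on pq.
    typed⇒graded : ∀ {s v} → Typed s v → Graded s v
    typed⇒graded {s} {v} ty with typed⇒4 {s} ty
    ... | i₄ , o₄ = in-ψ (PSide? v) , out-ψ (PSide? v) , To-≤ (m≤m+n 4 4) i₄ , From-≤ (m≤m+n 4 4) o₄
      where
      in-p : Typed s v → PSide v → ∀ k → dp v ≡ k → I s v (k + 2)
      in-p _ lt zero d≡ = subst (λ u → I s u 2) (sym (dist≡0 d≡)) at-p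
      in-p (inj₁ (i , _)) lt (suc k) d≡ = To-≤ (s≤s (m≤n+m 2 k)) i
      in-p (inj₂ (inj₁ (i , _))) lt (suc k) d≡ = To-≤ (≤-trans (n≤1+n 2) (s≤s (m≤n+m 2 k))) i
      in-p (inj₂ (inj₂ (inj₁ (_ , i , _)))) lt (suc k) d≡ = To-≤ (s≤s z≤n) i
      in-p (inj₂ (inj₂ (inj₂ (e , _ , _)))) lt (suc k) d≡ =
        contradiction (≤-trans (≤-trans (s≤s (≤-reflexive (sym d≡))) lt) (dist-walk (step e here))) λ { (s≤s ()) }
      out-q : Typed s v → QSide v → ∀ k → dq v ≡ k → O s v (k + 2)
      out-q _ ge zero d≡ = subst (λ u → O s u 2) (sym (dist≡0 d≡)) at-q
      out-q (inj₁ (_ , o)) ge (suc k) d≡ = From-≤ (≤-trans (n≤1+n 2) (s≤s (m≤n+m 2 k))) o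
      out-q (inj₂ (inj₁ (_ , o))) ge (suc k) d≡ = From-≤ (s≤s (m≤n+m 2 k)) o
      out-q (inj₂ (inj₂ (inj₂ (_ , _ , o)))) ge (suc k) d≡ = From-≤ (s≤s z≤n) o
      out-q (inj₂ (inj₂ (inj₁ (e , _ , _)))) ge (suc k) d≡ = contradiction (dist≡1 dq≡1) (no-triangle e)
        where
        dq≡1 : dq v ≡ 1
        dq≡1 = ≤-antisym (≤-trans ge (dist-walk (step e here))) (≤-trans (s≤s z≤n) (≤-reflexive (sym d≡)))
      in-ψ : Dec (PSide v) → I s v (ψ-in v)
      in-ψ (yes lt) = subst (I s v) (sym (ψ-in-p lt)) (in-p ty lt (dp v) refl)
      in-ψ (no ¬lt) = subst (I s v) (sym (ψ-in-q (≮⇒≥ ¬lt))) (To-≤ (≤-trans (m≤m+n 4 2) (∸-monoʳ-≤ 10 (dist≤4 q v))) i₄)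
      out-ψ : Dec (PSide v) → O s v (ψ-out v)
      out-ψ (yes lt) = subst (O s v) (sym (ψ-out-p lt)) (From-≤ (≤-trans (m≤m+n 4 2) (∸-monoʳ-≤ 10 (dist≤4 p v))) o₄)
      out-ψ (no ¬lt) = subst (O s v) (sym (ψ-out-q (≮⇒≥ ¬lt))) (out-q ty (≮⇒≥ ¬lt) (dq v) refl)

    Bounded : Partial E → Fin n → Set
    Bounded s v = Graded s v × I s v 4 × O s v 4

    Bounded-⊑ : ∀ {s t v} → s ⊑ t → Bounded s v → Bounded t v
    Bounded-⊑ e (g , i , o) = Graded-⊑ e g , I-⊑ e i , O-⊑ e o

    module _ (s : Partial E) (typed : AllTyped s) (p∈s : p ∈ verts s) (q∈s : q ∈ verts s)
             (near-p : ∀ v → E v p → v ∈ verts s) (near-q : ∀ v → E v q → v ∈ verts s) where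

      outside : ∀ {v} → v ∉ verts s → 2 ≤ dp v × 2 ≤ dq v
      outside {v} v∉ = by-p (dp v) refl , by-q (dq v) refl
        where
        by-p : ∀ k → dp v ≡ k → 2 ≤ dp v
        by-p 0 d≡ = contradiction (subst (_∈ verts s) (sym (dist≡0 d≡)) p∈s) v∉
        by-p 1 d≡ = contradiction (near-p v (dist≡1 d≡)) v∉
        by-p (suc (suc k)) d≡ = ≤-trans (s≤s (s≤s z≤n)) (≤-reflexive (sym d≡))
        by-q : ∀ k → dq v ≡ k → 2 ≤ dq v
        by-q 0 d≡ = contradiction (subst (_∈ verts s) (sym (dist≡0 d≡)) q∈s) v∉
        by-q 1 d≡ = contradiction (near-q v (dist≡1 d≡)) v∉
        by-q (suc (suc k)) d≡ = ≤-trans (s≤s (s≤s z≤n)) (≤-reflexive (sym d≡))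

      grown-above : ∀ {t} → s ⊑ t → (∀ {v} → v ∈ verts t → Graded t v) → Grown t
      grown-above e gr = grown gr (verts⊆ e p∈s) (verts⊆ e q∈s) (λ v∉ → outside (v∉ ∘ verts⊆ e))

      -- A vertex at distance 2 from both roots fits between a covered neighbour of q with out-bound
      -- 3 and a covered neighbour of p with in-bound 3, which makes it a hub. These hubs serve
      -- vertices at distance 4 from both roots.
      middles : ∃[ t ] (s ⊑ t × (∀ {v} → v ∈ verts t → Bounded t v) × (∀ v → dp v ≡ 2 → dq v ≡ 2 → v ∈ verts t))
      middles with coverAll (λ t → s ⊑ t × (∀ {v} → v ∈ verts t → Bounded t v)) (λ t v → dp v ≡ 2 → dq v ≡ 2 → v ∈ verts t)
                     (λ e d a b → verts⊆ e (d a b)) next s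
                     (⊑-refl , λ v∈ → typed⇒graded {s} (typed v∈) , typed⇒4 {s} (typed v∈))
        where
        next : ∀ t → s ⊑ t × (∀ {v} → v ∈ verts t → Bounded t v) → ∀ v →
          ∃[ u ] (t ⊑ u × (s ⊑ u × (∀ {v} → v ∈ verts u → Bounded u v)) × (dp v ≡ 2 → dq v ≡ 2 → v ∈ verts u))
        next t (s⊑t , bd) v with v ∈? verts t | dp v ≟ 2 | dq v ≟ 2
        ... | yes v∈ | _      | _     = t , ⊑-refl , (s⊑t , bd) , λ _ _ → v∈
        ... | no _   | no ≢2  | _     = t , ⊑-refl , (s⊑t , bd) , λ d≡ _ → contradiction d≡ ≢2
        ... | no _   | yes _  | no ≢2 = t , ⊑-refl , (s⊑t , bd) , λ _ d≡ → contradiction d≡ ≢2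
        ... | no v∉  | yes dp≡ | yes dq≡ with closer dp≡ | closer dq≡
        ...   | l , e-vl , dp-l | r , e-vr , dq-r with next-to-p no-triangle dp-l
        ...     | inj₁ refl = contradiction (≤-trans (≤-reflexive (sym dq≡)) (dist-walk (step e-vl here))) λ { (s≤s ()) }
        ...     | inj₂ lt-l =
          let u , t⊑u , bd-u , v∈ = pick (here refl)
                (ear Bounded Bounded-⊑ t bd (E-sym e-vr ◂ end e-vl) r∈ l∈ (v∉ ∷ []) ([] ∷ []) (inj₁ λ { refl → <⇒≱ lt-l ge-r })
                  λ { u e (a ◂ end b) →
                    let i = step b (I-⊑ e i-l)
                        o = step a (O-⊑ e o-r)
                    in ((subst (I u v) (sym ψ-in≡) (To-≤ (m≤m+n 4 4) i) , subst (O u v) (sym ψ-out≡) o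
                         , To-≤ (m≤m+n 4 4) i , From-≤ (m≤m+n 4 4) o) , i , o) ∷ [] })
          in u , t⊑u , (⊑-trans s⊑t t⊑u , bd-u) , λ _ _ → v∈
          where
          ge-r : QSide r
          ge-r with dp r in eq
          ... | suc _ = ≤-trans (≤-reflexive dq-r) (s≤s z≤n)
          ... | zero  = contradiction
            (≤-trans (≤-reflexive (sym dp≡)) (dist-walk (step (subst (E v) (dist≡0 eq) e-vr) here))) λ { (s≤s ()) }
          l∈ : l ∈ verts t
          l∈ = verts⊆ s⊑t (near-p l (dist≡1 dp-l))
          r∈ : r ∈ verts t
          r∈ = verts⊆ s⊑t (near-q r (dist≡1 dq-r))
          i-l : I t l 3
          i-l = subst (I t l) (trans (ψ-in-p lt-l) (cong (_+ 2) dp-l)) (proj₁ (proj₁ (bd l∈)))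
          o-r : O t r 3
          o-r = subst (O t r) (trans (ψ-out-q ge-r) (cong (_+ 2) dq-r)) (proj₁ (proj₂ (proj₁ (bd r∈))))
          ge-v : QSide v
          ge-v = ≤-reflexive (trans dq≡ (sym dp≡))
          ψ-in≡ : ψ-in v ≡ 8
          ψ-in≡ = trans (ψ-in-q ge-v) (cong (10 ∸_) dq≡)
          ψ-out≡ : ψ-out v ≡ 4
          ψ-out≡ = trans (ψ-out-q ge-v) (cong (_+ 2) dq≡)
      ... | t , _ , (s⊑t , bd) , all∈ = t , s⊑t , bd , all∈

      borders : ∀ {t} → Grown t → ∃[ u ] (t ⊑ u × Grown u × (∀ x → QSide x → ∃[ y ] (E x y × PSide y) → x ∈ verts u))
      borders {t} gr = coverAll Grown (λ u x → QSide x → ∃[ y ] (E x y × PSide y) → x ∈ verts u)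
        (λ e d a b → verts⊆ e (d a b)) next t gr
        where
        next : ∀ u → Grown u → ∀ x → ∃[ w ] (u ⊑ w × Grown w × (QSide x → ∃[ y ] (E x y × PSide y) → x ∈ verts w))
        next u gr′ x with x ∈? verts u | QSide? x | any? (λ y → E? x y ×-dec PSide? y)
        ... | yes x∈ | _      | _      = u , ⊑-refl , gr′ , λ _ _ → x∈
        ... | no _   | no ¬ge | _      = u , ⊑-refl , gr′ , λ ge _ → contradiction ge ¬ge
        ... | no _   | yes _  | no ¬y  = u , ⊑-refl , gr′ , λ _ y → contradiction y ¬y
        ... | no x∉  | yes ge | yes (y , e , lt) with cross gr′ e ge lt (inj₁ x∉)
        ...   | w , u⊑w , gr″ , a = w , u⊑w , gr″ , λ _ _ → tail∈ w a

      -- An uncovered w within 3 of a root is within two steps of a neighbour of that root, a hub.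
      -- Otherwise w is at distance 4 from both; let w, v, u begin a shortest path to p. If v is on
      -- the p-side, w is a covered border vertex. If u is the first on the p-side, v is a covered
      -- border vertex with out-bound 3 + 2. If neither is, u has distance 2 to both roots and is a
      -- hub.
      reach : ∀ {t} → s ⊑ t → Grown t → (∀ {v} → v ∈ verts s → Hub t v) → (∀ v → dp v ≡ 2 → dq v ≡ 2 → Hub t v) →
        (∀ x → QSide x → ∃[ y ] (E x y × PSide y) → x ∈ verts t) → ∀ w → Reachable t w
      reach {t} s⊑t gr hub-s hub-m border w with w ∈? verts t
      ... | yes w∈ = inj₁ w∈
      ... | no w∉ = by-p (dp w) refl
        where
        2≤dp : 2 ≤ dp w
        2≤dp = proj₁ (outside (w∉ ∘ verts⊆ s⊑t))
        2≤dq : 2 ≤ dq w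
        2≤dq = proj₂ (outside (w∉ ∘ verts⊆ s⊑t))

        adjacent : ∀ {r} → (∀ v → E v r → v ∈ verts s) → dist r w ≡ 2 → Reachable t w
        adjacent near d≡ with closer d≡
        ... | u , e-wu , du≡ with hub-s (near u (dist≡1 du≡))
        ...   | u∈ , i , _ = inj₂ (inj₁ (u , e-wu , u∈ , inj₁ (To-≤ (n≤1+n 4) i)))

        two-steps : ∀ {r} → (∀ v → E v r → v ∈ verts s) → dist r w ≡ 3 → Reachable t w
        two-steps near d≡ with closer d≡
        ... | u , e-wu , du≡ with closer du≡
        ...   | v , e-uv , dv≡ = inj₂ (inj₂ (u , v , e-wu , e-uv , hub-s (near v (dist≡1 dv≡))))

        antipodal : dp w ≡ 4 → dq w ≡ 4 → Reachable t w
        antipodal dp≡ dq≡ with closer dp≡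
        ... | v , e-wv , dp-v with PSide? v
        ...   | yes lt-v = contradiction (border w (≤-reflexive (trans dq≡ (sym dp≡))) (v , e-wv , lt-v)) w∉
        ...   | no ¬lt-v with closer dp-v
        ...     | u , e-vu , dp-u with PSide? u
        ...       | yes lt-u = inj₂ (inj₁ (v , e-wv , v∈ , inj₂ (From-≤ ψ≤5 (proj₁ (proj₂ (graded gr v∈))))))
          where
          v∈ : v ∈ verts t
          v∈ = border v (≮⇒≥ ¬lt-v) (u , e-vu , lt-u)
          ψ≤5 : ψ-out v ≤ 5
          ψ≤5 = ≤-trans (≤-reflexive (ψ-out-q (≮⇒≥ ¬lt-v))) (+-monoˡ-≤ 2 (≤-trans (≮⇒≥ ¬lt-v) (≤-reflexive dp-v)))
        ...       | no ¬lt-u = inj₂ (inj₂ (v , u , e-wv , e-vu , hub-m u dp-u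
          (≤-antisym (≤-trans (≮⇒≥ ¬lt-u) (≤-reflexive dp-u))
            (s≤s⁻¹ (s≤s⁻¹ (≤-trans (≤-reflexive (sym dq≡)) (≤-trans (dist-edge e-wv) (s≤s (dist-edge e-vu)))))))))

        by-q : dp w ≡ 4 → ∀ k → dq w ≡ k → Reachable t w
        by-q dp≡ 0 d≡ = contradiction (≤-trans 2≤dq (≤-reflexive d≡)) λ ()
        by-q dp≡ 1 d≡ = contradiction (≤-trans 2≤dq (≤-reflexive d≡)) λ { (s≤s ()) }
        by-q dp≡ 2 d≡ = adjacent near-q d≡
        by-q dp≡ 3 d≡ = two-steps near-q d≡
        by-q dp≡ 4 d≡ = antipodal dp≡ d≡
        by-q dp≡ (suc (suc (suc (suc (suc k))))) d≡ =
          contradiction (≤-trans (≤-reflexive (sym d≡)) (dist≤4 q w)) λ { (s≤s (s≤s (s≤s (s≤s ())))) }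

        by-p : ∀ k → dp w ≡ k → Reachable t w
        by-p 0 d≡ = contradiction (≤-trans 2≤dp (≤-reflexive d≡)) λ ()
        by-p 1 d≡ = contradiction (≤-trans 2≤dp (≤-reflexive d≡)) λ { (s≤s ()) }
        by-p 2 d≡ = adjacent near-p d≡
        by-p 3 d≡ = two-steps near-p d≡
        by-p 4 d≡ = by-q d≡ (dq w) refl
        by-p (suc (suc (suc (suc (suc k))))) d≡ =
          contradiction (≤-trans (≤-reflexive (sym d≡)) (dist≤4 p w)) λ { (s≤s (s≤s (s≤s (s≤s ())))) }

    -- The root of its own side is within 4 of v, and the slack 2 makes this the one-sided 6.
    graded⇒tame : ∀ {s v} → Graded s v → Tame s v
    graded⇒tame {s} {v} (i , o , i₈ , o₈) = i₈ , o₈ , side (PSide? v)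
      where
      side : Dec (PSide v) → I s v 6 ⊎ O s v 6
      side (yes lt) = inj₁ (To-≤ (≤-trans (≤-reflexive (ψ-in-p lt)) (+-monoˡ-≤ 2 (dist≤4 p v))) i)
      side (no ¬lt) = inj₂ (From-≤ (≤-trans (≤-reflexive (ψ-out-q (≮⇒≥ ¬lt))) (+-monoˡ-≤ 2 (dist≤4 q v))) o)

    orientable : Orientable
    orientable with core
    ... | s , typed , p∈s , q∈s , pq , (m , m≤3 , qp) , near-p , near-q
      with middles s typed p∈s q∈s near-p near-q
    ...   | t , s⊑t , bd , middle∈
      with borders s typed p∈s q∈s near-p near-q (grown-above s typed p∈s q∈s near-p near-q s⊑t (proj₁ ∘ bd))
    ...     | u , t⊑u , gr , border
      with complete bridgeless u (graded⇒tame {u} ∘ graded gr)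
             (reach s typed p∈s q∈s near-p near-q (⊑-trans s⊑t t⊑u) gr (λ v∈ → hub (verts⊆ s⊑t v∈)) (λ v a b → hub (middle∈ v a b)) border)
      where
      hub : ∀ {v} → v ∈ verts t → Hub u v
      hub v∈ = let _ , i , o = bd v∈ in Hub-⊑ t⊑u (v∈ , i , o)
    ...       | w , u⊑w , near = w , rooted⇒DiamLe 1 (1 , ≤-refl , step (arcs⊆ s⊑w pq) here) (m , m≤3 , Walk-map (arcs⊆ s⊑w) qp) near
      where
      s⊑w : s ⊑ w
      s⊑w = ⊑-trans s⊑t (⊑-trans t⊑u u⊑w)

  -- Choosing the case

  module _ (p q : Fin n) where

    Triangle : Set
    Triangle = ∃[ x ] (E p x × E x q)

    Square : Set
    Square = ∃[ x ] ∃[ y ] (E p x × E x y × E y q × x ≢ q × p ≢ y)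

    triangle? : Dec Triangle
    triangle? = any? λ x → E? p x ×-dec E? x q

    square? : Dec Square
    square? = any? λ x → any? λ y → E? p x ×-dec E? x y ×-dec E? y q ×-dec ¬? (x ≟ᶠ q) ×-dec ¬? (p ≟ᶠ y)

  orientable : Fin n → Orientable
  orientable r
    with any? (λ p → any? λ q → E? p q ×-dec ¬? (triangle? p q) ×-dec ¬? (square? q p))
       | any? (λ p → any? λ q → E? p q ×-dec ¬? (triangle? p q))
  ... | yes (p , q , e , ¬tri , ¬sq) | _ =
    no-short-cycle⇒orientable e (λ e-vp e-vq → ¬tri (_ , E-sym e-vp , e-vq))
      (λ e-qu e-uv e-vp u≢p v≢q → ¬sq (_ , _ , e-qu , e-uv , e-vp , u≢p , v≢q ∘ sym))
  ... | no _ | no none = triangles⇒orientable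
    (λ {u} {v} e → decidable-stable (triangle? u v) λ ¬tri → none (u , v , e , ¬tri)) r
  ... | no none | yes (p , q , e , ¬tri) =
    ShortCycles.orientable p q e (λ e-vp e-vq → ¬tri (_ , E-sym e-vp , e-vq)) short
    where
    short : ∀ {u v} → E u v → Triangle u v ⊎ Square u v
    short {u} {v} e-uv with triangle? u v | square? u v
    ... | yes tri | _      = inj₁ tri
    ... | no _    | yes sq = inj₂ sq
    ... | no ¬tri | no ¬sq = contradiction (v , u , E-sym e-uv , (λ (x , a , b) → ¬tri (x , E-sym b , E-sym a)) , ¬sq) none

-- Reduction to a decidable subgraph

walkArcs : {R : Fin n → Fin n → Set} → ∀ {u v k} → Walk R u v k → List (Fin n × Fin n)
walkArcs here                     = []
walkArcs (step {u = u} {w = w} _ ws) = (u , w) ∷ walkArcs ws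

walkArcs-sound : {R : Fin n → Fin n → Set} → ∀ {u v k x y} (w : Walk R u v k) → (x , y) ∈ walkArcs w → R x y
walkArcs-sound (step r w) (here refl) = r
walkArcs-sound (step r w) (there a)   = walkArcs-sound w a

along : {R : Fin n → Fin n → Set} → ∀ {u v k} (w : Walk R u v k) → Walk (λ x y → (x , y) ∈ walkArcs w × R x y) u v k
along here       = here
along (step r w) = step (here refl , r) (Walk-map (λ (a , r′) → there a , r′) (along w))

gather : (Fin n → Fin n → List (Fin n × Fin n)) → List (Fin n × Fin n)
gather {n} f = concatMap (λ u → concatMap (f u) (allFin n)) (allFin n)

gather⁺ : ∀ (f : Fin n → Fin n → List (Fin n × Fin n)) u v {a} → a ∈ f u v → a ∈ gather f
gather⁺ f u v a∈ = ∈-concatMap⁺ _ (lose (∈-allFin u) (∈-concatMap⁺ (f u) (lose (∈-allFin v) a∈)))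

gather⁻ : ∀ (f : Fin n → Fin n → List (Fin n × Fin n)) {a} → a ∈ gather f → ∃[ u ] ∃[ v ] a ∈ f u v
gather⁻ {n} f a∈ with find (∈-concatMap⁻ (λ u → concatMap (f u) (allFin n)) {xs = allFin n} a∈)
... | u , _ , a∈u with find (∈-concatMap⁻ (f u) {xs = allFin n} a∈u)
...   | v , _ , a∈v = u , v , a∈v

-- Adjacency need not be decidable, so we pass to the subgraph formed by the edges of finitely many
-- walks: the given ones of length ≤ 4, and, for every edge ab on these, one from a to b avoiding ab.
module Witnessed (G : Graph) (2-connected : TwoEdgeConnected G) (diam : DiamLe (Adj G) 4) where

  private
    N = Graph.n G

    V² : Set
    V² = Fin N × Fin N

    short : Fin N → Fin N → List V²
    short u v = walkArcs (proj₂ (proj₂ (diam u v)))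

    shorts : List V²
    shorts = gather short

    shorts-sound : ∀ {u v} → (u , v) ∈ shorts → Adj G u v
    shorts-sound a with gather⁻ short a
    ... | u , v , a∈ = walkArcs-sound (proj₂ (proj₂ (diam u v))) a∈

    bypass : ∀ {a b} → (a , b) ∈ shorts → ∃[ k ] Walk (DeleteEdge G a b) a b k
    bypass {a} {b} e = proj₂ 2-connected a b (shorts-sound e) a b

    bypassArcs : ∀ {a b} → Dec ((a , b) ∈ shorts) → List V²
    bypassArcs (yes e) = walkArcs (proj₂ (bypass e))
    bypassArcs (no _)  = []

    bypasses : Fin N → Fin N → List V²
    bypasses a b = bypassArcs ((a , b) ∈ᵃ? shorts)

    edges : List V²
    edges = shorts ++ gather bypasses

    edges-sound : ∀ {u v} → (u , v) ∈ edges → Adj G u v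
    edges-sound e with ∈-++⁻ shorts e
    ... | inj₁ e∈ = shorts-sound e∈
    ... | inj₂ e∈ with gather⁻ bypasses e∈
    ...   | a , b , e∈ab with (a , b) ∈ᵃ? shorts
    ...     | yes ab = proj₁ (walkArcs-sound (proj₂ (bypass ab)) e∈ab)

    Either : List V² → Fin N → Fin N → Set
    Either es u v = (u , v) ∈ es ⊎ (v , u) ∈ es

    swap : ∀ {es u v} → Either es u v → Either es v u
    swap (inj₁ a) = inj₂ a
    swap (inj₂ a) = inj₁ a

  E : Fin N → Fin N → Set
  E = Either edges

  E? : ∀ u v → Dec (E u v)
  E? u v = ((u , v) ∈ᵃ? edges) ⊎-dec ((v , u) ∈ᵃ? edges)

  E-sym : ∀ {u v} → E u v → E v u
  E-sym = swap

  E⇒Adj : ∀ {u v} → E u v → Adj G u v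
  E⇒Adj (inj₁ e) = edges-sound e
  E⇒Adj (inj₂ e) = Graph.sym G (edges-sound e)

  E-irrefl : ∀ {u} → ¬ E u u
  E-irrefl e = Graph.irrefl G (E⇒Adj e)

  E-diam : DiamLe E 4
  E-diam u v = let m , m≤4 , w = diam u v in
    m , m≤4 , Walk-map (λ (a , _) → inj₁ (∈-++⁺ˡ (gather⁺ short u v a))) (along w)

  bypass-E : ∀ {a b} → (a , b) ∈ shorts → ∃[ k ] Walk (Avoiding E a b) a b k
  bypass-E {a} {b} e = by ((a , b) ∈ᵃ? shorts) refl
    where
    by : (d : Dec ((a , b) ∈ shorts)) → (a , b) ∈ᵃ? shorts ≡ d → ∃[ k ] Walk (Avoiding E a b) a b k
    by (no ¬e)  _  = contradiction e ¬e
    by (yes e′) d≡ = let k , w = bypass e′ in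
      k , Walk-map (λ (x∈ , _ , avoids) →
            inj₁ (∈-++⁺ʳ shorts (gather⁺ bypasses a b (subst (λ d → _ ∈ bypassArcs d) (sym d≡) x∈))) , avoids) (along w)

  -- Adding the bypasses starts no regress: an edge uv that lies on no short walk in either
  -- direction is avoided by the short walk from u to v.
  E-bridgeless : ∀ {u v} → E u v → ∃[ k ] Walk (Avoiding E u v) u v k
  E-bridgeless {u} {v} _ with (u , v) ∈ᵃ? shorts | (v , u) ∈ᵃ? shorts
  ... | yes e | _     = bypass-E e
  ... | no _  | yes e = let k , w = bypass-E e in
    _ , Walk-map (λ (a , ¬b , ¬c) → a , ¬c , ¬b) (Walk-reverse (λ (a , ¬b , ¬c) → E-sym a , (λ (x , y) → ¬c (y , x)) , λ (x , y) → ¬b (y , x)) w here)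
  ... | no ¬e | no ¬e′ = let m , _ , w = diam u v in
    m , Walk-map (λ (a , _) → let e = gather⁺ short u v a in
          inj₁ (∈-++⁺ˡ e) , (λ { (refl , refl) → ¬e e }) , λ { (refl , refl) → ¬e′ e }) (along w)

theorem5 : (G : Graph) → TwoEdgeConnected G → HasDiameter G 4 →
    ∃[ D ] (IsOrientation G D × DiamLe D 21)
theorem5 G 2-connected (diam , r , _) with Bridgeless.orientable E E? E-sym E-irrefl E-diam E-bridgeless r
  where open Witnessed G 2-connected diam
... | s , diam₂₁ = D , ((λ _ _ → proj₁) , orients) , λ u v →
    let m , m≤21 , w = diam₂₁ u v in m , m≤21 , Walk-map (λ a → Witnessed.E⇒Adj G 2-connected diam (allowed s a) , inj₁ a) w
  where
  D : Fin (Graph.n G) → Fin (Graph.n G) → Set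
  -- Edges left open by s point to the larger index. This choice cannot lengthen distances, as the
  -- paths of length at most 21 use arcs of s alone.
  D u v = Adj G u v × ((u , v) ∈ arcs s ⊎ ((v , u) ∉ arcs s × toℕ u < toℕ v))

  orients : ∀ u v → Adj G u v → (D u v × ¬ D v u) ⊎ (D v u × ¬ D u v)
  orients u v uv with (u , v) ∈ᵃ? arcs s | (v , u) ∈ᵃ? arcs s
  ... | yes a | _     = inj₁ ((uv , inj₁ a) , λ { (_ , inj₁ b) → anti s a b ; (_ , inj₂ (¬a , _)) → ¬a a })
  ... | no _  | yes b = inj₂ ((Graph.sym G uv , inj₁ b) , λ { (_ , inj₁ a) → anti s a b ; (_ , inj₂ (¬b , _)) → ¬b b })
  ... | no ¬a | no ¬b with <-cmp (toℕ u) (toℕ v)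
  ...   | tri< u<v _ ¬v<u = inj₁ ((uv , inj₂ (¬b , u<v)) , λ { (_ , inj₁ b) → ¬b b ; (_ , inj₂ (_ , v<u)) → ¬v<u v<u })
  ...   | tri≈ _ u≡v _    = contradiction (subst (Adj G u) (sym (toℕ-injective u≡v)) uv) (Graph.irrefl G)
  ...   | tri> ¬u<v _ v<u = inj₂ ((Graph.sym G uv , inj₂ (¬a , v<u)) , λ { (_ , inj₁ a) → ¬a a ; (_ , inj₂ (_ , u<v)) → ¬u<v u<v })
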